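{- There is an absolute constant $c>0$ such that the following holds. Let $k\ge 2$ be an integer and let $G=(V,E,w)$ be a finite edge-weighted graph on $n\ge k$ vertices. For any real $\gamma<2$, there are at most $$ \left(\max\left(\frac{1}{2-\gamma},\,k\right)\right)^{c k}\, n $$ many cuts of $G$ with weight less than $\gamma\overline{\lambda}_k$.
   Context: Graphs are finite, without self-loops, with positive rational edge weights. A $k$-cut of $G$ is a set of edges whose deletion leaves at least $k$ connected components; $\lambda_k$ is the minimum total weight of a $k$-cut of $G$, and $\overline{\lambda}_k:=\lambda_k/k$. A cut of $G$ is a set $S$ with $\emptyset\ne S\subsetneq V$; its weight is $w(\partial S)$, the total weight of the edges with exactly one endpoint in $S$. -}

module Defs where

open import Data.Bool.Base using (if_then_else_; _xor_)
open import Data.Fin.Base using (Fin)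
open import Data.Fin.Subset using (Subset; Nonempty; ⊤; _⊂_; _∉_)
open import Data.List.Base using (List; length)
open import Data.List.Relation.Unary.All using (All)
open import Data.List.Relation.Unary.Unique.Propositional using (Unique)
open import Data.Integer.Base as ℤ using (ℤ)
open import Data.Nat.Base as ℕ using (ℕ; zero; suc)
import Data.Nat.Properties as ℕ
open import Data.Product.Base using (Σ; ∃; _×_; _,_)
open import Data.Rational.Base as ℚ using (ℚ; 0ℚ; 1ℚ; ½)
import Data.Rational.Properties as ℚ
open import Data.Rational.Solver using (module +-*-Solver)
open import Data.Sum.Base using (inj₁; inj₂)
open import Data.Vec.Base using (lookup; tabulate)
open import Function.Bundles using (Injection)
open import Level using (0ℓ)
open import Relation.Binary.Bundles using (Setoid)
open import Relation.Binary.Construct.Closure.Equivalence as EqClosure using (EqClosure)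
open import Relation.Binary.Core using (Rel)
open import Relation.Binary.PropositionalEquality as ≡
  using (_≡_; _≢_; refl; sym; trans; cong; cong₂; subst; subst₂)
open import Relation.Nullary using (¬_; yes; no; contradiction)
open import Algebra.Properties.CommutativeMonoid.Sum ℚ.+-0-commutativeMonoid using (sum)

-- Parallel edges are allowed.  The order of the two endpoints of an
-- edge carries no meaning.
record Graph (n : ℕ) : Set where
  field
    #edges   : ℕ
    src tgt  : Fin #edges → Fin n
    noLoop   : ∀ e → src e ≢ tgt e
    weight   : Fin #edges → ℚ
    positive : ∀ e → 0ℚ ℚ.< weight e

module _ {n : ℕ} (G : Graph n) where
  open Graph G

  totalWeight : Subset #edges → ℚ
  totalWeight F = sum λ e → if lookup F e then weight e else 0ℚ

  AdjacentAvoiding : Subset #edges → Rel (Fin n) 0ℓ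
  AdjacentAvoiding F u v = ∃ λ e → e ∉ F × src e ≡ u × tgt e ≡ v

  -- The elements of this setoid are the connected components of G - F,
  -- each component being represented by any of its vertices.
  Components : Subset #edges → Setoid 0ℓ 0ℓ
  Components F = EqClosure.setoid (AdjacentAvoiding F)

  -- "At least k components", as an injection up to connectedness.
  IsKCut : ℕ → Subset #edges → Set
  IsKCut k F = Injection (≡.setoid (Fin k)) (Components F)

  IsMinKCutWeight : ℕ → ℚ → Set
  IsMinKCutWeight k q =
    (∃ λ F → IsKCut k F × totalWeight F ≡ q) ×
    (∀ F → IsKCut k F → q ℚ.≤ totalWeight F)

  ∂ : Subset n → Subset #edges
  ∂ S = tabulate λ e → lookup S (src e) xor lookup S (tgt e)

IsCut : ∀ {n} → Subset n → Set
IsCut S = Nonempty S × S ⊂ ⊤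

average : ℚ → (k : ℕ) → .{{ℕ.NonZero k}} → ℚ
average q k = q ℚ.* (ℤ.1ℤ ℚ./ k)

private
  ∣p-q∣<r : ∀ p q r → p ℚ.< q ℚ.+ r → q ℚ.< p ℚ.+ r → ℚ.∣ p ℚ.- q ∣ ℚ.< r
  ∣p-q∣<r p q r p<q+r q<p+r with ℚ.∣p∣≡p∨∣p∣≡-p (p ℚ.- q)
  ... | inj₁ eq = subst₂ ℚ._<_ (sym eq) (lem q r) (ℚ.+-monoˡ-< (ℚ.- q) p<q+r)
    where
    lem : ∀ a b → a ℚ.+ b ℚ.- a ≡ b
    lem = solve 2 (λ a b → a :+ b :- a := b) refl where open +-*-Solver
  ... | inj₂ eq = subst₂ ℚ._<_ (trans (lem′ q p) (sym eq)) (lem p r) (ℚ.+-monoˡ-< (ℚ.- p) q<p+r)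
    where
    open +-*-Solver
    lem : ∀ a b → a ℚ.+ b ℚ.- a ≡ b
    lem = solve 2 (λ a b → a :+ b :- a := b) refl
    lem′ : ∀ a b → a ℚ.- b ≡ ℚ.- (b ℚ.- a)
    lem′ = solve 2 (λ a b → a :- b := :- (b :- a)) refl

  p<q+∣p-q∣ : ∀ p q r → ℚ.∣ p ℚ.- q ∣ ℚ.< r → p ℚ.< q ℚ.+ r
  p<q+∣p-q∣ p q r h = subst (ℚ._< q ℚ.+ r) (lem p q)
    (ℚ.+-monoʳ-< q (ℚ.≤-<-trans (p≤∣p∣ (p ℚ.- q)) h))
    where
    open +-*-Solver
    lem : ∀ a b → b ℚ.+ (a ℚ.- b) ≡ a
    lem = solve 2 (λ a b → b :+ (a :- b) := a) refl
    p≤∣p∣ : ∀ x → x ℚ.≤ ℚ.∣ x ∣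
    p≤∣p∣ x with ℚ.≤-total 0ℚ x
    ... | inj₁ 0≤x = ℚ.≤-reflexive (sym (ℚ.0≤p⇒∣p∣≡p 0≤x))
    ... | inj₂ x≤0 = ℚ.≤-trans x≤0 (ℚ.0≤∣p∣ x)

  ∣p-q∣≡∣q-p∣ : ∀ p q → ℚ.∣ p ℚ.- q ∣ ≡ ℚ.∣ q ℚ.- p ∣
  ∣p-q∣≡∣q-p∣ p q = trans (sym (ℚ.∣-p∣≡∣p∣ (p ℚ.- q))) (cong ℚ.∣_∣ (lem p q))
    where
    open +-*-Solver
    lem : ∀ a b → ℚ.- (a ℚ.- b) ≡ b ℚ.- a
    lem = solve 2 (λ a b → :- (a :- b) := b :- a) refl

  ½+½ : ∀ p → ½ ℚ.* p ℚ.+ ½ ℚ.* p ≡ p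
  ½+½ p = trans (sym (ℚ.*-distribʳ-+ p ½ ½)) (ℚ.*-identityˡ p)

  0<½* : ∀ {p} → 0ℚ ℚ.< p → 0ℚ ℚ.< ½ ℚ.* p
  0<½* {p} h = subst (ℚ._< ½ ℚ.* p) (ℚ.*-zeroʳ ½) (ℚ.*-monoʳ-<-pos ½ h)

  0<* : ∀ {p q} → 0ℚ ℚ.< p → 0ℚ ℚ.< q → 0ℚ ℚ.< p ℚ.* q
  0<* {p} {q} 0<p 0<q = subst (ℚ._< p ℚ.* q) (ℚ.*-zeroʳ p)
    (ℚ.*-monoʳ-<-pos p {{ℚ.positive 0<p}} 0<q)

  ⊔-close : ∀ p q r s ε → p ℚ.< r ℚ.+ ε → q ℚ.< s ℚ.+ ε → p ℚ.⊔ q ℚ.< (r ℚ.⊔ s) ℚ.+ ε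
  ⊔-close p q r s ε h k with ℚ.⊔-sel p q
  ... | inj₁ eq = subst (ℚ._< _) (sym eq) (ℚ.<-≤-trans h (ℚ.+-monoˡ-≤ ε (ℚ.p≤p⊔q r s)))
  ... | inj₂ eq = subst (ℚ._< _) (sym eq) (ℚ.<-≤-trans k (ℚ.+-monoˡ-≤ ε (ℚ.p≤q⊔p r s)))

  *-mono-nonNeg : ∀ {p q r s} → 0ℚ ℚ.≤ p → 0ℚ ℚ.≤ s → p ℚ.≤ q → r ℚ.≤ s → p ℚ.* r ℚ.≤ q ℚ.* s
  *-mono-nonNeg {p} {q} {r} {s} 0≤p 0≤s p≤q r≤s = ℚ.≤-trans
    (ℚ.*-monoˡ-≤-nonNeg p {{ℚ.nonNegative 0≤p}} r≤s)
    (ℚ.*-monoʳ-≤-nonNeg s {{ℚ.nonNegative 0≤s}} p≤q)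

  inverse : ∀ {p} → 0ℚ ℚ.< p → Σ ℚ λ q → 0ℚ ℚ.< q × q ℚ.* p ≡ 1ℚ
  inverse {p} 0<p = ℚ.1/ p , ℚ.positive⁻¹ (ℚ.1/ p) {{ℚ.1/pos⇒pos p}} , ℚ.*-inverseˡ p
    where instance _ = ℚ.positive 0<p
                   _ = ℚ.pos⇒nonZero p

-- The value at 0 is immaterial: `1/` below applies this pointwise to
-- sequences that are eventually bounded away from 0.
recip : ℚ → ℚ
recip p with p ℚ.≟ 0ℚ
... | yes _   = 0ℚ
... | no  p≢0 = ℚ.1/_ p {{ℚ.≢-nonZero p≢0}}

private
  recip-inverse : ∀ p → 0ℚ ℚ.< p → recip p ℚ.* p ≡ 1ℚ
  recip-inverse p 0<p with p ℚ.≟ 0ℚ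
  ... | yes p≡0 = contradiction (sym p≡0) (ℚ.<⇒≢ 0<p)
  ... | no  p≢0 = ℚ.*-inverseˡ p {{ℚ.≢-nonZero p≢0}}

  recip-diff : ∀ {p q} → 0ℚ ℚ.< p → 0ℚ ℚ.< q →
               recip p ℚ.- recip q ≡ recip p ℚ.* recip q ℚ.* (q ℚ.- p)
  recip-diff {p} {q} 0<p 0<q = sym (trans
    (lem (recip p) (recip q) p q)
    (trans (cong₂ (λ a b → recip p ℚ.* a ℚ.- recip q ℚ.* b)
                  (recip-inverse q 0<q) (recip-inverse p 0<p))
           (cong₂ ℚ._-_ (ℚ.*-identityʳ (recip p)) (ℚ.*-identityʳ (recip q)))))
    where
    open +-*-Solver
    lem : ∀ a b p q → a ℚ.* b ℚ.* (q ℚ.- p) ≡ a ℚ.* (b ℚ.* q) ℚ.- b ℚ.* (a ℚ.* p)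
    lem = solve 4 (λ a b p q → a :* b :* (q :- p) := a :* (b :* q) :- b :* (a :* p)) refl

  recip-pos : ∀ {p} → 0ℚ ℚ.< p → 0ℚ ℚ.≤ recip p
  recip-pos {p} 0<p with p ℚ.≟ 0ℚ
  ... | yes _   = ℚ.≤-refl
  ... | no  p≢0 = ℚ.<⇒≤ (ℚ.positive⁻¹ (ℚ.1/_ p {{ℚ.≢-nonZero p≢0}})
                          {{ℚ.1/pos⇒pos p {{ℚ.positive 0<p}}}})

  recip-bound : ∀ {p δ D} → 0ℚ ℚ.< δ → 0ℚ ℚ.< D → D ℚ.* δ ≡ 1ℚ → δ ℚ.≤ p → recip p ℚ.≤ D
  recip-bound {p} {δ} {D} 0<δ 0<D Dδ≡1 δ≤p = subst₂ ℚ._≤_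
    (trans (lem (recip p) D δ) (trans (cong (recip p ℚ.*_) Dδ≡1) (ℚ.*-identityʳ _)))
    (trans (lem′ (recip p) D p) (trans (cong (D ℚ.*_) (recip-inverse p 0<p)) (ℚ.*-identityʳ _)))
    (*-mono-nonNeg (subst (ℚ._≤ recip p ℚ.* D) (ℚ.*-zeroʳ (recip p))
                     (ℚ.*-monoˡ-≤-nonNeg (recip p) {{ℚ.nonNegative (recip-pos 0<p)}} (ℚ.<⇒≤ 0<D)))
                   (ℚ.<⇒≤ 0<p) ℚ.≤-refl δ≤p)
    where
    0<p = ℚ.<-≤-trans 0<δ δ≤p
    open +-*-Solver
    lem : ∀ a D δ → a ℚ.* D ℚ.* δ ≡ a ℚ.* (D ℚ.* δ)
    lem = solve 3 (λ a D δ → a :* D :* δ := a :* (D :* δ)) refl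
    lem′ : ∀ a D p → a ℚ.* D ℚ.* p ≡ D ℚ.* (a ℚ.* p)
    lem′ = solve 3 (λ a D p → a :* D :* p := D :* (a :* p)) refl

IsCauchy : (ℕ → ℚ) → Set
IsCauchy x = ∀ ε → 0ℚ ℚ.< ε →
  ∃ λ N → ∀ i j → N ℕ.≤ i → N ℕ.≤ j → ℚ.∣ x i ℚ.- x j ∣ ℚ.< ε

-- Reals are Cauchy sequences of rationals; distinct sequences may
-- represent the same number.
record ℝ : Set where
  constructor mkℝ
  field
    seq    : ℕ → ℚ
    cauchy : IsCauchy seq

open ℝ public

infix 4 _<_ _≤_
infixl 6 _-_ _⊔_
infixl 7 _*_
infixr 8 _^_

-- The gap ε makes the order independent of the choice of Cauchy
-- sequences: eventual pointwise inequality would not be.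
_<_ : ℝ → ℝ → Set
x < y = ∃ λ ε → 0ℚ ℚ.< ε × ∃ λ N → ∀ i → N ℕ.≤ i → seq x i ℚ.+ ε ℚ.≤ seq y i

_≤_ : ℝ → ℝ → Set
x ≤ y = ¬ (y < x)

fromℚ : ℚ → ℝ
fromℚ q = mkℝ (λ _ → q) λ ε 0<ε →
  0 , λ _ _ _ _ → subst (ℚ._< ε) (sym (cong ℚ.∣_∣ (ℚ.+-inverseʳ q))) 0<ε

fromℕ : ℕ → ℝ
fromℕ n = fromℚ (ℤ.+ n ℚ./ 1)

_-_ : ℝ → ℝ → ℝ
x - y = mkℝ (λ i → seq x i ℚ.- seq y i) λ ε 0<ε →
  let M , hM = cauchy x (½ ℚ.* ε) (0<½* 0<ε)
      N , hN = cauchy y (½ ℚ.* ε) (0<½* 0<ε)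
  in M ℕ.⊔ N , λ i j p q →
    let a = seq x i; b = seq y i; c = seq x j; d = seq y j in
    ℚ.≤-<-trans
      (subst (ℚ._≤ ℚ.∣ a ℚ.- c ∣ ℚ.+ ℚ.∣ d ℚ.- b ∣) (cong ℚ.∣_∣ (lem a b c d))
        (ℚ.∣p+q∣≤∣p∣+∣q∣ (a ℚ.- c) (d ℚ.- b)))
      (subst (ℚ.∣ a ℚ.- c ∣ ℚ.+ ℚ.∣ d ℚ.- b ∣ ℚ.<_) (½+½ ε)
        (ℚ.+-mono-< (hM i j (ℕ.m⊔n≤o⇒m≤o M N p) (ℕ.m⊔n≤o⇒m≤o M N q))
                    (hN j i (ℕ.m⊔n≤o⇒n≤o M N q) (ℕ.m⊔n≤o⇒n≤o M N p))))
  where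
  open +-*-Solver
  lem : ∀ a b c d → a ℚ.- c ℚ.+ (d ℚ.- b) ≡ a ℚ.- b ℚ.- (c ℚ.- d)
  lem = solve 4 (λ a b c d → a :- c :+ (d :- b) := a :- b :- (c :- d)) refl

_⊔_ : ℝ → ℝ → ℝ
x ⊔ y = mkℝ (λ i → seq x i ℚ.⊔ seq y i) λ ε 0<ε →
  let M , hM = cauchy x ε 0<ε
      N , hN = cauchy y ε 0<ε
      close : ∀ i j → M ℕ.⊔ N ℕ.≤ i → M ℕ.⊔ N ℕ.≤ j →
              seq x i ℚ.⊔ seq y i ℚ.< (seq x j ℚ.⊔ seq y j) ℚ.+ ε
      close i j p q = ⊔-close (seq x i) (seq y i) (seq x j) (seq y j) ε
        (p<q+∣p-q∣ (seq x i) (seq x j) ε (hM i j (ℕ.m⊔n≤o⇒m≤o M N p) (ℕ.m⊔n≤o⇒m≤o M N q)))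
        (p<q+∣p-q∣ (seq y i) (seq y j) ε (hN i j (ℕ.m⊔n≤o⇒n≤o M N p) (ℕ.m⊔n≤o⇒n≤o M N q)))
  in M ℕ.⊔ N , λ i j p q → ∣p-q∣<r _ _ ε (close i j p q) (close j i q p)

private
  bounded : ∀ x → Σ ℚ λ B → 0ℚ ℚ.< B × ∃ λ N → ∀ i → N ℕ.≤ i → ℚ.∣ seq x i ∣ ℚ.≤ B
  bounded x =
    let N , h = cauchy x 1ℚ (ℚ.positive⁻¹ 1ℚ)
        b = seq x N
    in ℚ.∣ b ∣ ℚ.+ 1ℚ
     , ℚ.+-mono-≤-< (ℚ.0≤∣p∣ b) (ℚ.positive⁻¹ 1ℚ)
     , N , λ i N≤i → ℚ.≤-trans
         (subst (λ a → ℚ.∣ a ∣ ℚ.≤ ℚ.∣ b ∣ ℚ.+ ℚ.∣ seq x i ℚ.- b ∣) (lem (seq x i) b)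
           (ℚ.∣p+q∣≤∣p∣+∣q∣ b (seq x i ℚ.- b)))
         (ℚ.+-monoʳ-≤ ℚ.∣ b ∣ (ℚ.<⇒≤ (h i N N≤i ℕ.≤-refl)))
    where
    open +-*-Solver
    lem : ∀ a b → b ℚ.+ (a ℚ.- b) ≡ a
    lem = solve 2 (λ a b → b :+ (a :- b) := a) refl

  scaled : ∀ p A D ε → p ℚ.< D ℚ.* ε → 0ℚ ℚ.< A → D ℚ.* A ≡ 1ℚ → A ℚ.* p ℚ.< ε
  scaled p A D ε h 0<A DA≡1 = subst (A ℚ.* p ℚ.<_)
    (trans (lem A D ε) (trans (cong (ℚ._* ε) DA≡1) (ℚ.*-identityˡ ε)))
    (ℚ.*-monoʳ-<-pos A {{ℚ.positive 0<A}} h)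
    where
    open +-*-Solver
    lem : ∀ A D ε → A ℚ.* (D ℚ.* ε) ≡ D ℚ.* A ℚ.* ε
    lem = solve 3 (λ A D ε → A :* (D :* ε) := D :* A :* ε) refl

_*_ : ℝ → ℝ → ℝ
x * y = mkℝ (λ i → seq x i ℚ.* seq y i) λ ε 0<ε →
  let A , 0<A , K , hA = bounded x
      B , 0<B , L , hB = bounded y
      A⁻¹ , 0<A⁻¹ , A⁻¹A≡1 = inverse 0<A
      B⁻¹ , 0<B⁻¹ , B⁻¹B≡1 = inverse 0<B
      M , hM = cauchy x (B⁻¹ ℚ.* (½ ℚ.* ε)) (0<* 0<B⁻¹ (0<½* 0<ε))
      N , hN = cauchy y (A⁻¹ ℚ.* (½ ℚ.* ε)) (0<* 0<A⁻¹ (0<½* 0<ε))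
      P = (K ℕ.⊔ L) ℕ.⊔ (M ℕ.⊔ N)
      P⇒K = λ {i} (p : P ℕ.≤ i) → ℕ.m⊔n≤o⇒m≤o K L (ℕ.m⊔n≤o⇒m≤o (K ℕ.⊔ L) _ p)
      P⇒L = λ {i} (p : P ℕ.≤ i) → ℕ.m⊔n≤o⇒n≤o K L (ℕ.m⊔n≤o⇒m≤o (K ℕ.⊔ L) _ p)
      P⇒M = λ {i} (p : P ℕ.≤ i) → ℕ.m⊔n≤o⇒m≤o M N (ℕ.m⊔n≤o⇒n≤o (K ℕ.⊔ L) _ p)
      P⇒N = λ {i} (p : P ℕ.≤ i) → ℕ.m⊔n≤o⇒n≤o M N (ℕ.m⊔n≤o⇒n≤o (K ℕ.⊔ L) _ p)
  in P , λ i j p q →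
    let a = seq x i; b = seq y i; c = seq x j; d = seq y j
        left : ℚ.∣ a ℚ.* (b ℚ.- d) ∣ ℚ.< ½ ℚ.* ε
        left = subst (ℚ._< ½ ℚ.* ε) (sym (ℚ.∣p*q∣≡∣p∣*∣q∣ a (b ℚ.- d))) (ℚ.≤-<-trans
          (*-mono-nonNeg (ℚ.0≤∣p∣ a) (ℚ.0≤∣p∣ (b ℚ.- d)) (hA i (P⇒K p)) ℚ.≤-refl)
          (scaled (ℚ.∣ b ℚ.- d ∣) A A⁻¹ (½ ℚ.* ε) (hN i j (P⇒N p) (P⇒N q)) 0<A A⁻¹A≡1))
        right : ℚ.∣ d ℚ.* (a ℚ.- c) ∣ ℚ.< ½ ℚ.* ε
        right = subst (ℚ._< ½ ℚ.* ε) (sym (ℚ.∣p*q∣≡∣p∣*∣q∣ d (a ℚ.- c))) (ℚ.≤-<-trans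
          (*-mono-nonNeg (ℚ.0≤∣p∣ d) (ℚ.0≤∣p∣ (a ℚ.- c)) (hB j (P⇒L q)) ℚ.≤-refl)
          (scaled (ℚ.∣ a ℚ.- c ∣) B B⁻¹ (½ ℚ.* ε) (hM i j (P⇒M p) (P⇒M q)) 0<B B⁻¹B≡1))
    in ℚ.≤-<-trans
      (subst (ℚ._≤ ℚ.∣ a ℚ.* (b ℚ.- d) ∣ ℚ.+ ℚ.∣ d ℚ.* (a ℚ.- c) ∣) (cong ℚ.∣_∣ (lem a b c d))
        (ℚ.∣p+q∣≤∣p∣+∣q∣ (a ℚ.* (b ℚ.- d)) (d ℚ.* (a ℚ.- c))))
      (subst (ℚ.∣ a ℚ.* (b ℚ.- d) ∣ ℚ.+ ℚ.∣ d ℚ.* (a ℚ.- c) ∣ ℚ.<_) (½+½ ε)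
        (ℚ.+-mono-< left right))
  where
  open +-*-Solver
  lem : ∀ a b c d → a ℚ.* (b ℚ.- d) ℚ.+ d ℚ.* (a ℚ.- c) ≡ a ℚ.* b ℚ.- c ℚ.* d
  lem = solve 4 (λ a b c d → a :* (b :- d) :+ d :* (a :- c) := a :* b :- c :* d) refl

_^_ : ℝ → ℕ → ℝ
x ^ zero  = fromℕ 1
x ^ suc n = x * x ^ n

1/ : (x : ℝ) → fromℕ 0 < x → ℝ
1/ x (δ , 0<δ , K , hK) = mkℝ (λ i → recip (seq x i)) λ ε 0<ε →
  let D , 0<D , Dδ≡1 = inverse 0<δ
      0<DD = 0<* 0<D 0<D
      E , 0<E , EDD≡1 = inverse 0<DD
      M , hM = cauchy x (E ℚ.* ε) (0<* 0<E 0<ε)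
  in K ℕ.⊔ M , λ i j p q →
    let a = seq x i; b = seq x j
        δ≤ : ∀ i → K ℕ.⊔ M ℕ.≤ i → δ ℚ.≤ seq x i
        δ≤ i p = subst (ℚ._≤ seq x i) (ℚ.+-identityˡ δ) (hK i (ℕ.m⊔n≤o⇒m≤o K M p))
        0<a = ℚ.<-≤-trans 0<δ (δ≤ i p)
        0<b = ℚ.<-≤-trans 0<δ (δ≤ j q)
        r = recip a ℚ.* recip b
        0≤r = subst (ℚ._≤ r) (ℚ.*-zeroʳ (recip a))
                (ℚ.*-monoˡ-≤-nonNeg (recip a) {{ℚ.nonNegative (recip-pos 0<a)}} (recip-pos 0<b))
        r≤DD = *-mono-nonNeg (recip-pos 0<a) (ℚ.<⇒≤ 0<D)
                 (recip-bound 0<δ 0<D Dδ≡1 (δ≤ i p)) (recip-bound 0<δ 0<D Dδ≡1 (δ≤ j q))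
    in subst (ℚ._< ε)
         (sym (trans (cong ℚ.∣_∣ (recip-diff 0<a 0<b))
              (trans (ℚ.∣p*q∣≡∣p∣*∣q∣ r (b ℚ.- a))
                     (cong₂ ℚ._*_ (ℚ.0≤p⇒∣p∣≡p 0≤r) (∣p-q∣≡∣q-p∣ b a)))))
         (ℚ.≤-<-trans
           (*-mono-nonNeg 0≤r (ℚ.0≤∣p∣ (a ℚ.- b)) r≤DD ℚ.≤-refl)
           (scaled (ℚ.∣ a ℚ.- b ∣) (D ℚ.* D) E ε (hM i j (ℕ.m⊔n≤o⇒n≤o K M p) (ℕ.m⊔n≤o⇒n≤o K M q)) 0<DD EDD≡1))

x<y⇒0<y-x : ∀ x y → x < y → fromℕ 0 < y - x
x<y⇒0<y-x x y (ε , 0<ε , N , h) = ε , 0<ε , N , λ i N≤i →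
  subst (ℚ._≤ seq y i ℚ.- seq x i) (lem (seq x i) ε)
    (ℚ.+-monoˡ-≤ (ℚ.- seq x i) (h i N≤i))
  where
  open +-*-Solver
  lem : ∀ a e → a ℚ.+ e ℚ.- a ≡ 0ℚ ℚ.+ e
  lem = solve 2 (λ a e → a :+ e :- a := con 0ℚ :+ e) refl

-- The number of elements satisfying P is bounded by b when every
-- duplicate-free list of such elements has length at most b.
AtMost : {A : Set} → ℝ → (A → Set) → Set
AtMost {A} b P = (xs : List A) → Unique xs → All P xs → fromℕ (length xs) ≤ b

{-# OPTIONS --safe #-}
module Submission where

open import Defs
open import Data.Nat.Base as ℕ using (ℕ; zero; suc; z≤n; s≤s; NonZero)
open import Data.Rational.Base as ℚ using (ℚ; 0ℚ; 1ℚ)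
open import Data.Product.Base using (∃; ∃₂; _×_; _,_; proj₁; proj₂)
open import Data.Fin.Subset using (Subset; ∣_∣)
import Data.Nat.Properties as ℕ
import Data.Rational.Properties as ℚ
open import Algebra.Properties.CommutativeMonoid.Mult ℚ.+-0-commutativeMonoid using (×-distrib-+)
open import Algebra.Properties.CommutativeMonoid.Sum ℚ.+-0-commutativeMonoid using (sum; ∑-distrib-+; sum-cong-≗)
open import Algebra.Properties.Monoid.Mult ℚ.+-0-monoid using (×-assocˡ) renaming (_×_ to _·_)
open import Data.Bool.Base using (Bool; true; false; if_then_else_; not; _∧_; _∨_; _xor_)
import Data.Bool.Properties as Bool
open import Data.Empty using (⊥; ⊥-elim)
open import Data.Fin.Base using (Fin; zero; suc)
import Data.Fin.Properties as Fin
open import Data.Fin.Subset.Properties using (anySubset?; p⊂q⇒∣p∣<∣q∣)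
open import Data.Integer.Base as ℤ using (+_)
import Data.Integer.Properties as ℤ
open import Data.List.Base using (List; []; _∷_; length; map; filter; allFin; _++_)
open import Data.List.Membership.Propositional using (_∈_; find; lose)
open import Data.List.Membership.Propositional.Properties using (∈-∃++; ∈-++⁻; ∈-++⁺ˡ; ∈-++⁺ʳ; ∈-filter⁻; ∈-allFin)
import Data.List.Properties as List
open import Data.List.Relation.Unary.All as All using (All; []; _∷_)
import Data.List.Relation.Unary.All.Properties as All
open import Data.List.Relation.Unary.AllPairs using (AllPairs; []; _∷_)
open import Data.List.Relation.Unary.Any as Any using (Any; here; there)
open import Data.List.Relation.Unary.Unique.Propositional using (Unique)
open import Data.List.Relation.Unary.Unique.Propositional.Properties using (filter⁺)
import Data.Nat.DivMod as ℕ
open import Data.Nat.Induction using (<-wellFounded; Acc; acc)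
open import Data.Rational.Solver using (module +-*-Solver)
open import Data.Rational.Unnormalised.Base as ℚᵘ using (mkℚᵘ; *≡*)
import Data.Rational.Unnormalised.Properties as ℚᵘ
open import Data.Sum.Base using (_⊎_; inj₁; inj₂)
open import Data.Vec.Base using ([]; _∷_; lookup; tabulate)
open import Data.Vec.Properties using (lookup∘tabulate; lookup⇒[]=; []=⇒lookup; tabulate∘lookup; tabulate-cong)
open import Function.Base using (_∘_)
import Relation.Binary.Construct.Closure.Equivalence as EqClosure
open import Relation.Binary.PropositionalEquality
  using (_≡_; _≢_; refl; sym; trans; cong; cong₂; subst; subst₂; isEquivalence)
open import Relation.Nullary using (¬_; Dec; yes; no; contradiction; does)
open import Relation.Nullary.Decidable using (dec-true; dec-false; _×-dec_; ¬?)
open import Relation.Unary using (Decidable)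

-- Let u = λₖ/k, and call a vertex set strong when every splitting of the subgraph it induces
-- costs at least u.  Splitting off pieces at cost below u, starting from {A , V ∖ A} for a
-- cut A of weight below 2u, ends in a partition P(A) into strong classes; it has fewer than
-- k classes, as k of them would be a k-cut of weight below ku.  A cut B of weight below
-- 2u crosses at most one class of P(A), so outside that class it is one of at most 2ᵏ sets.
--
-- Given a family of such cuts, take a class Z of least size among the classes of all P(A)
-- crossed by a member of the family.  If B crosses Z, then one of the sides of B in Z is a
-- union of fewer than k classes of P(B), none of which is crossed by the family.  Hence a
-- sunflower argument bounds the number of members having a given vertex of Z on that
-- side: in a sunflower with nonempty core, submodularity joins each petal to the core by
-- weight at least u/2m (with m ≥ 1/(2-γ)), while a single member cuts all these edges
-- but those of its own petal.  So two vertices of Z are separated by at least one but only few members.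
-- Removing those merges the two vertices, which can happen fewer than n times.

-- Cardinality bounds through duplicate-free lists.

Card≤ : {A : Set} → ℕ → (A → Set) → Set
Card≤ {A} b P = (xs : List A) → Unique xs → All P xs → length xs ℕ.≤ b

module _ {A : Set} where

  private variable
    P Q R : A → Set
    a b : ℕ

  card-mono : a ℕ.≤ b → (∀ {x} → P x → Q x) → Card≤ a Q → Card≤ b P
  card-mono a≤b P⊆Q h xs u ps = ℕ.≤-trans (h xs u (All.map P⊆Q ps)) a≤b

  -- The empty list satisfies every bound, so a member may be assumed. Later this supplies facts
  -- that hold only when some cut is present, and picks petals.
  card-if-inhabited : (∀ {x} → P x → Card≤ b P) → Card≤ b P
  card-if-inhabited h []       _ _        = z≤n
  card-if-inhabited h (x ∷ xs) u (p ∷ ps) = h p (x ∷ xs) u (p ∷ ps)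

  card-∅ : (∀ {x} → ¬ P x) → Card≤ 0 P
  card-∅ ¬P = card-if-inhabited λ p → contradiction p ¬P

  card-subsingleton : (∀ {x y} → P x → P y → x ≡ y) → Card≤ 1 P
  card-subsingleton h []           _             _             = z≤n
  card-subsingleton h (_ ∷ [])     _             _             = s≤s z≤n
  card-subsingleton h (_ ∷ _ ∷ _) ((x≢y ∷ _) ∷ _) (p ∷ q ∷ _) = contradiction (h p q) x≢y

  private
    record Split (Q R : A → Set) (xs : List A) : Set₁ where
      constructor split
      field
        {left right} : List A
        left-unique  : Unique left
        right-unique : Unique right
        left-all     : All Q left
        right-all    : All R right
        -- Being a sublist is recorded by its effect on `All`: this is what carries the freshness of
        -- a head over to each part.
        left-⊆       : ∀ {S : A → Set} → All S xs → All S left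
        right-⊆      : ∀ {S : A → Set} → All S xs → All S right
        length-+     : length xs ≡ length left ℕ.+ length right

    splitList : (∀ {x} → P x → Q x ⊎ R x) → ∀ {xs} → Unique xs → All P xs → Split Q R xs
    splitList f [] [] = split [] [] [] [] (λ _ → []) (λ _ → []) refl
    splitList f (x∉xs ∷ u) (p ∷ ps) with f p | splitList f u ps
    ... | inj₁ q | split u₁ u₂ qs rs l r eq =
      split (l x∉xs ∷ u₁) u₂ (q ∷ qs) rs (λ { (s ∷ ss) → s ∷ l ss }) (λ { (s ∷ ss) → r ss }) (cong suc eq)
    ... | inj₂ q | split {ys} {zs} u₁ u₂ qs rs l r eq =
      split u₁ (r x∉xs ∷ u₂) qs (q ∷ rs) (λ { (s ∷ ss) → l ss }) (λ { (s ∷ ss) → s ∷ r ss })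
        (trans (cong suc eq) (sym (ℕ.+-suc (length ys) (length zs))))

  card-⊎ : (∀ {x} → P x → Q x ⊎ R x) → Card≤ a Q → Card≤ b R → Card≤ (a ℕ.+ b) P
  card-⊎ {a = a} {b = b} f hQ hR xs u ps with splitList f u ps
  ... | split u₁ u₂ qs rs _ _ eq = subst (ℕ._≤ a ℕ.+ b) (sym eq) (ℕ.+-mono-≤ (hQ _ u₁ qs) (hR _ u₂ rs))

  card-Fin : ∀ N {Q : Fin N → A → Set} → (∀ {x} → P x → ∃ λ i → Q i x) → (∀ i → Card≤ b (Q i)) → Card≤ (N ℕ.* b) P
  card-Fin zero    f h = card-∅ λ p → Fin.¬Fin0 (proj₁ (f p))
  card-Fin {P = P} (suc N) {Q} f h = card-⊎ g (h zero) (card-Fin N {λ i → Q (suc i)} (λ q → q) (λ i → h (suc i)))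
    where
    g : ∀ {x} → P x → Q zero x ⊎ ∃ λ i → Q (suc i) x
    g p with f p
    ... | zero  , q = inj₁ q
    ... | suc i , q = inj₂ (i , q)

  card-Subset : ∀ N {Q : Subset N → A → Set} → (∀ {x} → P x → ∃ λ t → Q t x) → (∀ t → Card≤ b (Q t)) →
                Card≤ (2 ℕ.^ N ℕ.* b) P
  card-Subset {b = b} zero {Q} f h = card-mono (ℕ.m≤m+n b 0) g (h [])
    where
    g : ∀ {x} → _ → Q [] x
    g p with f p
    ... | [] , q = q
  card-Subset {P = P} {b = b} (suc N) {Q} f h =
    card-mono (ℕ.≤-reflexive eq) g
      (card-⊎ (λ q → q) (card-Subset N {λ t → Q (false ∷ t)} (λ q → q) (λ t → h (false ∷ t)))
                        (card-Subset N {λ t → Q (true ∷ t)} (λ q → q) (λ t → h (true ∷ t))))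
    where
    eq : 2 ℕ.^ N ℕ.* b ℕ.+ 2 ℕ.^ N ℕ.* b ≡ 2 ℕ.^ suc N ℕ.* b
    eq = trans (sym (ℕ.*-distribʳ-+ b (2 ℕ.^ N) (2 ℕ.^ N)))
               (cong (λ x → (2 ℕ.^ N ℕ.+ x) ℕ.* b) (sym (ℕ.+-identityʳ (2 ℕ.^ N))))
    g : ∀ {x} → P x → (∃ λ t → Q (false ∷ t) x) ⊎ (∃ λ t → Q (true ∷ t) x)
    g p with f p
    ... | false ∷ t , q = inj₁ (t , q)
    ... | true  ∷ t , q = inj₂ (t , q)

-- Least witnesses and Boolean bookkeeping.

least : {D : ℕ → Set} → Decidable D → ∀ {s} → D s → ∃ λ m → D m × (∀ {t} → t ℕ.< m → ¬ D t)
least {D} D? {s} d = go s d (<-wellFounded s)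
  where
  go : ∀ s → D s → Acc ℕ._<_ s → ∃ λ m → D m × (∀ {t} → t ℕ.< m → ¬ D t)
  go s d (acc rec) with ℕ.anyUpTo? D? s
  ... | yes (t , t<s , dt) = go t dt (rec t<s)
  ... | no  none           = s , d , λ t<s dt → none (_ , t<s , dt)

true≢false : true ≢ false
true≢false ()

true-or-false : ∀ a → a ≡ true ⊎ a ≡ false
true-or-false true  = inj₁ refl
true-or-false false = inj₂ refl

from-does : {P : Set} (d : Dec P) → does d ≡ true → P
from-does (yes p) _ = p

∧-intro : ∀ {a b} → a ≡ true → b ≡ true → a ∧ b ≡ true
∧-intro refl refl = refl

∧-elim : ∀ {a b} → a ∧ b ≡ true → a ≡ true × b ≡ true
∧-elim {true} {true} _ = refl , refl

not-elim : ∀ {a} → not a ≡ true → a ≡ false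
not-elim {false} _ = refl

not-intro : ∀ {a} → a ≡ false → not a ≡ true
not-intro refl = refl

<⇒≱ℚ : ∀ {p q} → p ℚ.< q → ¬ (q ℚ.≤ p)
<⇒≱ℚ p<q q≤p = ℚ.<-irrefl refl (ℚ.<-≤-trans p<q q≤p)

sum-mono : ∀ {n} {f g : Fin n → ℚ} → (∀ i → f i ℚ.≤ g i) → sum f ℚ.≤ sum g
sum-mono {zero}  h = ℚ.≤-refl
sum-mono {suc n} h = ℚ.+-mono-≤ (h zero) (sum-mono (h ∘ suc))

-- Vertex sets, crossings and colour classes.

VSet : ℕ → Set
VSet n = Fin n → Bool

module _ {n : ℕ} where

  _∩_ _∖_ : VSet n → VSet n → VSet n
  (P ∩ Q) v = P v ∧ Q v
  (P ∖ Q) v = P v ∧ not (Q v)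

  Crosses : VSet n → VSet n → Set
  Crosses C P = ∃₂ λ v w → (P v ≡ true × C v ≡ true) × (P w ≡ true × C w ≡ false)

  crosses? : ∀ C P → Dec (Crosses C P)
  crosses? C P = Fin.any? λ v → Fin.any? λ w →
    (P v Bool.≟ true ×-dec C v Bool.≟ true) ×-dec (P w Bool.≟ true ×-dec C w Bool.≟ false)

  uncrossed : ∀ {C P} → ¬ Crosses C P → ∀ {v w} → P v ≡ true → P w ≡ true → C v ≡ C w
  uncrossed {C} ¬cr {v} {w} Pv Pw with C v in Cv | C w in Cw
  ... | true  | true  = refl
  ... | false | false = refl
  ... | true  | false = contradiction (v , w , (Pv , Cv) , (Pw , Cw)) ¬cr
  ... | false | true  = contradiction (w , v , (Pw , Cw) , (Pv , Cv)) ¬cr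

  class : ∀ {p} → (Fin n → Fin p) → Fin p → VSet n
  class col i v = does (col v Fin.≟ i)

  class-intro : ∀ {p} (col : Fin n → Fin p) {i v} → col v ≡ i → class col i v ≡ true
  class-intro col eq = dec-true (col _ Fin.≟ _) eq

  class-elim : ∀ {p} (col : Fin n → Fin p) {i v} → class col i v ≡ true → col v ≡ i
  class-elim col = from-does (col _ Fin.≟ _)

-- Weights of edge sets and splittings.

module Weights {n : ℕ} (G : Graph n) where
  open Graph G

  private
    E : Set
    E = Fin #edges

    val : Bool → ℚ → ℚ
    val b x = if b then x else 0ℚ

    weight≥0 : ∀ e → 0ℚ ℚ.≤ weight e
    weight≥0 e = ℚ.<⇒≤ (positive e)

  wt : (E → Bool) → ℚ
  wt φ = sum λ e → if φ e then weight e else 0ℚ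

  wt-cong : ∀ {φ ψ} → (∀ e → φ e ≡ ψ e) → wt φ ≡ wt ψ
  wt-cong h = sum-cong-≗ λ e → cong (λ b → if b then weight e else 0ℚ) (h e)

  wt-∪-disjoint : ∀ {φ ψ χ} → (∀ {e} → φ e ≡ true → ψ e ≡ true → ⊥) →
                  (∀ {e} → φ e ≡ true → χ e ≡ true) → (∀ {e} → ψ e ≡ true → χ e ≡ true) →
                  wt φ ℚ.+ wt ψ ℚ.≤ wt χ
  wt-∪-disjoint {φ} {ψ} {χ} disj φ⊆χ ψ⊆χ = ℚ.≤-trans
    (ℚ.≤-reflexive (sym (∑-distrib-+ (λ e → val (φ e) (weight e)) (λ e → val (ψ e) (weight e)))))
    (sum-mono λ e → bits (φ e) (ψ e) (χ e) (weight≥0 e) (disj {e}) (φ⊆χ {e}) (ψ⊆χ {e}))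
    where
    bits : ∀ a b c {x} → 0ℚ ℚ.≤ x → (a ≡ true → b ≡ true → ⊥) → (a ≡ true → c ≡ true) → (b ≡ true → c ≡ true) →
           val a x ℚ.+ val b x ℚ.≤ val c x
    bits true  true  _     0≤x d _ _ = ⊥-elim (d refl refl)
    bits true  false true  0≤x d _ _ = ℚ.≤-reflexive (ℚ.+-identityʳ _)
    bits true  false false 0≤x d h _ = contradiction (sym (h refl)) true≢false
    bits false true  true  0≤x d _ _ = ℚ.≤-reflexive (ℚ.+-identityˡ _)
    bits false true  false 0≤x d _ h = contradiction (sym (h refl)) true≢false
    bits false false true  0≤x d _ _ = ℚ.≤-trans (ℚ.≤-reflexive (ℚ.+-identityˡ 0ℚ)) 0≤x
    bits false false false 0≤x d _ _ = ℚ.≤-reflexive (ℚ.+-identityˡ 0ℚ)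

  wt-cover : ∀ {φ ψ χ} → (∀ {e} → χ e ≡ true → φ e ≡ true ⊎ ψ e ≡ true) → wt χ ℚ.≤ wt φ ℚ.+ wt ψ
  wt-cover {φ} {ψ} {χ} h = ℚ.≤-trans
    (sum-mono λ e → bits (φ e) (ψ e) (χ e) (weight≥0 e) (h {e}))
    (ℚ.≤-reflexive (∑-distrib-+ (λ e → val (φ e) (weight e)) (λ e → val (ψ e) (weight e))))
    where
    val≥0 : ∀ b {x} → 0ℚ ℚ.≤ x → 0ℚ ℚ.≤ val b x
    val≥0 true  0≤x = 0≤x
    val≥0 false _   = ℚ.≤-refl
    bits : ∀ a b c {x} → 0ℚ ℚ.≤ x → (c ≡ true → a ≡ true ⊎ b ≡ true) → val c x ℚ.≤ val a x ℚ.+ val b x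
    bits a b false {x} 0≤x _ = subst (ℚ._≤ val a x ℚ.+ val b x) (ℚ.+-identityˡ 0ℚ) (ℚ.+-mono-≤ (val≥0 a 0≤x) (val≥0 b 0≤x))
    bits a b true {x} 0≤x h with h refl
    ... | inj₁ refl = subst (ℚ._≤ x ℚ.+ val b x) (ℚ.+-identityʳ x) (ℚ.+-monoʳ-≤ x (val≥0 b 0≤x))
    ... | inj₂ refl = subst (ℚ._≤ val a x ℚ.+ x) (ℚ.+-identityˡ x) (ℚ.+-monoˡ-≤ x (val≥0 a 0≤x))

  wt-∅ : ∀ {φ} → (∀ e → φ e ≡ false) → wt φ ≡ 0ℚ
  wt-∅ h = trans (wt-cong h) (zeros #edges)
    where
    zeros : ∀ m → sum {m} (λ _ → 0ℚ) ≡ 0ℚ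
    zeros zero    = refl
    zeros (suc m) = trans (ℚ.+-identityˡ _) (zeros m)

  wt-mono : ∀ {φ ψ} → (∀ {e} → φ e ≡ true → ψ e ≡ true) → wt φ ℚ.≤ wt ψ
  wt-mono {φ} {ψ} h = subst (wt φ ℚ.≤_) (trans (cong (wt ψ ℚ.+_) (wt-∅ {λ _ → false} (λ _ → refl))) (ℚ.+-identityʳ _))
    (wt-cover {ψ} {λ _ → false} {φ} (inj₁ ∘ h))

  wt≥0 : ∀ φ → 0ℚ ℚ.≤ wt φ
  wt≥0 φ = subst (ℚ._≤ wt φ) (wt-∅ {λ _ → false} (λ _ → refl)) (wt-mono {λ _ → false} {φ} λ ())

  joins : VSet n → VSet n → E → Bool
  joins P Q e = (P (src e) ∧ Q (tgt e)) ∨ (P (tgt e) ∧ Q (src e))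

  joins-cases : ∀ {P Q e} → joins P Q e ≡ true →
                (P (src e) ≡ true × Q (tgt e) ≡ true) ⊎ (P (tgt e) ≡ true × Q (src e) ≡ true)
  joins-cases {P} {Q} {e} h with P (src e) | Q (tgt e) | P (tgt e) | Q (src e)
  ... | true  | true  | _    | _    = inj₁ (refl , refl)
  ... | true  | false | true | true = inj₂ (refl , refl)
  ... | false | _     | true | true = inj₂ (refl , refl)

  joins-intro₁ : ∀ {P Q e} → P (src e) ≡ true → Q (tgt e) ≡ true → joins P Q e ≡ true
  joins-intro₁ p q rewrite p | q = refl

  joins-intro₂ : ∀ {P Q e} → P (tgt e) ≡ true → Q (src e) ≡ true → joins P Q e ≡ true
  joins-intro₂ {P} {Q} {e} p q rewrite p | q = Bool.∨-zeroʳ (P (src e) ∧ Q (tgt e))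

  joins-sym : ∀ {P Q e} → joins P Q e ≡ true → joins Q P e ≡ true
  joins-sym {P} {Q} {e} h with joins-cases {P} {Q} {e} h
  ... | inj₁ (p , q) = joins-intro₂ {Q} {P} q p
  ... | inj₂ (p , q) = joins-intro₁ {Q} {P} q p

  joins-monoʳ : ∀ {P Q R e} → (∀ {v} → Q v ≡ true → R v ≡ true) → joins P Q e ≡ true → joins P R e ≡ true
  joins-monoʳ {P} {Q} {R} {e} Q⊆R h with joins-cases {P} {Q} {e} h
  ... | inj₁ (p , q) = joins-intro₁ {P} {R} p (Q⊆R q)
  ... | inj₂ (p , q) = joins-intro₂ {P} {R} p (Q⊆R q)

  boundary : VSet n → E → Bool
  boundary A e = A (src e) xor A (tgt e)

  boundary-intro : ∀ {A e} → A (src e) ≢ A (tgt e) → boundary A e ≡ true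
  boundary-intro {A} {e} ne with A (src e) | A (tgt e)
  ... | true  | true  = contradiction refl ne
  ... | true  | false = refl
  ... | false | true  = refl
  ... | false | false = contradiction refl ne

  -- The boundary weight of `P ∩ C` in the subgraph induced by `P`.
  splitWeight : VSet n → VSet n → ℚ
  splitWeight P C = wt (joins (P ∩ C) (P ∖ C))

  bichromatic : ∀ {p} → (Fin n → Fin p) → E → Bool
  bichromatic col e = not (does (col (src e) Fin.≟ col (tgt e)))

  bichromatic-elim : ∀ {p} (col : Fin n → Fin p) {e} → bichromatic col e ≡ true → col (src e) ≢ col (tgt e)
  bichromatic-elim col {e} h eq = contradiction (trans (sym h) (cong not (dec-true (col _ Fin.≟ col _) eq))) true≢false

  bichromatic-intro : ∀ {p} (col : Fin n → Fin p) {e} → col (src e) ≢ col (tgt e) → bichromatic col e ≡ true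
  bichromatic-intro col {e} ne = cong not (dec-false (col _ Fin.≟ col _) ne)

  split-class : ∀ {C P} {e} → joins (P ∩ C) (P ∖ C) e ≡ true →
                (P (src e) ≡ true × P (tgt e) ≡ true) × C (src e) ≢ C (tgt e)
  split-class {C} {P} h with joins-cases {P ∩ C} {P ∖ C} h
  ... | inj₁ (a , b) = (proj₁ (∧-elim a) , proj₁ (∧-elim b)) ,
    λ eq → true≢false (trans (sym (proj₂ (∧-elim a))) (trans eq (not-elim (proj₂ (∧-elim b)))))
  ... | inj₂ (a , b) = (proj₁ (∧-elim b) , proj₁ (∧-elim a)) ,
    λ eq → true≢false (trans (sym (proj₂ (∧-elim a))) (trans (sym eq) (not-elim (proj₂ (∧-elim b)))))

  split-intro : ∀ {C P} {e} → P (src e) ≡ true → P (tgt e) ≡ true → C (src e) ≢ C (tgt e) →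
                joins (P ∩ C) (P ∖ C) e ≡ true
  split-intro {C} {P} {e} Ps Pt ne rewrite Ps | Pt with C (src e) | C (tgt e)
  ... | true  | true  = contradiction refl ne
  ... | true  | false = refl
  ... | false | true  = refl
  ... | false | false = contradiction refl ne

  splitWeight-mono : ∀ {P Q C} → (∀ {v} → Q v ≡ true → P v ≡ true) → splitWeight Q C ℚ.≤ splitWeight P C
  splitWeight-mono {P} {Q} {C} Q⊆P = wt-mono λ {e} h → let (Qs , Qt) , ne = split-class {C} {Q} h in
    split-intro {C} {P} {e} (Q⊆P Qs) (Q⊆P Qt) ne

  -- Serves to isolate the edges between a core and a petal, which then occur in the boundaries of
  -- both.
  splitWeight-≤ : ∀ X P Q → splitWeight X P ℚ.≤ wt (joins P Q) ℚ.+ wt (joins P ((X ∖ P) ∖ Q))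
  splitWeight-≤ X P Q = wt-cover λ {e} → cover {e}
    where
    R = (X ∖ P) ∖ Q
    cover : ∀ {e} → joins (X ∩ P) (X ∖ P) e ≡ true → joins P Q e ≡ true ⊎ joins P R e ≡ true
    cover {e} h with joins-cases {X ∩ P} {X ∖ P} {e} h
    ... | inj₁ (a , c) with true-or-false (Q (tgt e))
    ...   | inj₁ q = inj₁ (joins-intro₁ {P} {Q} (proj₂ (∧-elim a)) q)
    ...   | inj₂ q = inj₂ (joins-intro₁ {P} {R} (proj₂ (∧-elim a)) (∧-intro c (not-intro q)))
    cover {e} h | inj₂ (a , c) with true-or-false (Q (src e))
    ...   | inj₁ q = inj₁ (joins-intro₂ {P} {Q} (proj₂ (∧-elim a)) q)
    ...   | inj₂ q = inj₂ (joins-intro₂ {P} {R} (proj₂ (∧-elim a)) (∧-intro c (not-intro q)))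

  -- Decomposition into strong classes.

  module Decompose (k : ℕ) (u : ℚ) (0<u : 0ℚ ℚ.< u)
    (k-colouring : (col : Fin n → Fin k) → (∀ i → ∃ λ v → col v ≡ i) → k · u ℚ.≤ wt (bichromatic col)) where

    Strong : VSet n → Set
    Strong P = ∀ C → Crosses C P → u ℚ.≤ splitWeight P C

    Monochromatic : {A : Set} → (Fin n → A) → VSet n → Set
    Monochromatic f Q = ∀ {x y} → Q x ≡ true → Q y ≡ true → f x ≡ f y

    -- Decided by exhaustive search over `Subset n`; an arbitrary `C` is reached through its
    -- tabulation, with which it agrees pointwise.
    cheapSplit? : ∀ {p} (col : Fin n → Fin p) →
      (∀ i → Strong (class col i)) ⊎
      (∃₂ λ i C → Crosses C (class col i) × splitWeight (class col i) C ℚ.< u)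
    cheapSplit? col with Fin.any? (λ i → anySubset? λ C →
        crosses? (lookup C) (class col i) ×-dec (splitWeight (class col i) (lookup C) ℚ.<? u))
    ... | yes (i , C , h) = inj₂ (i , lookup C , h)
    ... | no  none        = inj₁ λ i C (v , w , (Pv , Cv) , (Pw , Cw)) → ℚ.≮⇒≥ λ lt →
      let eq = lookup∘tabulate C in
      none (i , tabulate C , (v , w , (Pv , trans (eq v) Cv) , (Pw , trans (eq w) Cw)) ,
        subst (ℚ._< u) (wt-cong λ e → sym (cong₂ _∨_ (part i C (src e) (tgt e)) (part i C (tgt e) (src e)))) lt)
      where
      part : ∀ i C v w → (class col i ∩ lookup (tabulate C)) v ∧ (class col i ∖ lookup (tabulate C)) w ≡
                         (class col i ∩ C) v ∧ (class col i ∖ C) w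
      part i C v w = cong₂ (λ a b → (class col i v ∧ a) ∧ (class col i w ∧ not b)) (lookup∘tabulate C v) (lookup∘tabulate C w)

    module Split {p} (col : Fin n → Fin p) (i : Fin p) (C : VSet n)
                 (crossing : Crosses C (class col i)) (cheap : splitWeight (class col i) C ℚ.< u) where

      cut-off : VSet n
      cut-off = class col i ∩ C

      col′ : Fin n → Fin (suc p)
      col′ v = if cut-off v then zero else suc (col v)

      col′-coarse : ∀ {v w} → col′ v ≡ col′ w → col v ≡ col w
      col′-coarse {v} {w} eq with cut-off v in hv | cut-off w in hw | eq
      ... | true  | true  | _    = trans (class-elim col (proj₁ (∧-elim hv))) (sym (class-elim col (proj₁ (∧-elim hw))))
      ... | false | false | refl′ = Fin.suc-injective refl′

      col′-fine : ∀ {v w} → col v ≡ col w → (class col i v ≡ true → class col i w ≡ true → C v ≡ C w) → col′ v ≡ col′ w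
      col′-fine {v} {w} eq h with col v | col w | eq
      ... | c | .c | refl with does (c Fin.≟ i)
      ...   | false = refl
      ...   | true  rewrite h refl refl = refl

      -- The two witnesses of `crossing` show that both parts of the split class are nonempty.
      col′-onto : (∀ j → ∃ λ v → col v ≡ j) → ∀ j → ∃ λ v → col′ v ≡ j
      col′-onto onto zero = let v , w , (Pv , Cv) , _ = crossing in
        v , cong (λ b → if b then zero else suc (col v)) (∧-intro Pv Cv)
      col′-onto onto (suc j) with j Fin.≟ i
      ... | yes refl = let v , w , _ , (Pw , Cw) = crossing in
        w , trans (cong (λ b → if b then zero else suc (col w))
                        (trans (cong (class col i w ∧_) Cw) (Bool.∧-zeroʳ _)))
                  (cong suc (class-elim col Pw))
      ... | no j≢i   = let v , eq = onto j in
        v , trans (cong (λ b → if b ∧ C v then zero else suc (col v))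
                        (dec-false (col v Fin.≟ i) λ eq′ → j≢i (trans (sym eq) eq′)))
                  (cong suc eq)

      -- Only the edges of the split become newly bichromatic, and they weigh less than `u`.
      col′-cost : wt (bichromatic col) ℚ.< p · u → wt (bichromatic col′) ℚ.< suc p · u
      col′-cost cost = ℚ.≤-<-trans
        (wt-cover {joins (class col i ∩ C) (class col i ∖ C)} {bichromatic col} {bichromatic col′} cover)
        (ℚ.+-mono-< cheap cost)
        where
        cover : ∀ {e} → bichromatic col′ e ≡ true →
                joins (class col i ∩ C) (class col i ∖ C) e ≡ true ⊎ bichromatic col e ≡ true
        cover {e} h with joins (class col i ∩ C) (class col i ∖ C) e in j
        ... | true  = inj₁ refl
        ... | false = inj₂ (bichromatic-intro col λ eq → bichromatic-elim col′ h (col′-fine eq λ Ps Pt → agree Ps Pt))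
          where
          agree : class col i (src e) ≡ true → class col i (tgt e) ≡ true → C (src e) ≡ C (tgt e)
          agree Ps Pt with C (src e) Bool.≟ C (tgt e)
          ... | yes eq = eq
          ... | no  ne = contradiction (trans (sym (split-intro {C} {class col i} Ps Pt ne)) j) true≢false

      -- If the split separated `Q`, then `Q` would lie inside the class being split and inherit a
      -- splitting cheaper than `u`.
      col′-absorbs : ∀ {Q} → Strong Q → Monochromatic col Q → Monochromatic col′ Q
      col′-absorbs {Q} strong mono {x} {y} Qx Qy = col′-fine (mono Qx Qy) λ Px Py →
        uncrossed {C = C} {Q} (λ cr → <⇒≱ℚ cheap (ℚ.≤-trans (strong C cr)
            (splitWeight-mono {class col i} {Q} {C} λ {v} Qv → class-intro col (trans (mono Qv Qx) (class-elim col Px)))))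
          Qx Qy

    -- The last three fields make the nonempty classes exactly the maximal nonempty strong sets on
    -- which `f` is constant.
    record Refines {A : Set} (f : Fin n → A) {p} (colour : Fin n → Fin p) : Set where
      field
        #classes< : p ℕ.< k
        refines   : ∀ {x y} → colour x ≡ colour y → f x ≡ f y
        strong    : ∀ i → Strong (class colour i)
        absorbs   : ∀ {Q} → Strong Q → Monochromatic f Q → Monochromatic colour Q

    IsCheapCut : VSet n → Set
    IsCheapCut A = (∃ λ v → A v ≡ true) × (∃ λ v → A v ≡ false) × wt (boundary A) ℚ.< u ℚ.+ u

    side : Bool → Fin 2
    side b = if b then suc zero else zero

    side-injective : ∀ a b → side a ≡ side b → a ≡ b
    side-injective true  true  _ = refl
    side-injective false false _ = refl

    abstract

      -- The invariant is a cost below `p · u` with every colour in use. If the fuel ran out, `p`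
      -- would be `k` and `k-colouring` would be violated, so the splitting stops earlier, at strong
      -- classes.
      refine : ∀ fuel {p} (col : Fin n → Fin p) → fuel ℕ.+ p ≡ k → (∀ j → ∃ λ v → col v ≡ j) →
               wt (bichromatic col) ℚ.< p · u → ∃₂ λ q (colour : Fin n → Fin q) → Refines col colour
      refine zero    col refl onto cost = contradiction (k-colouring col onto) (<⇒≱ℚ cost)
      refine (suc fuel) {p} col eq onto cost with cheapSplit? col
      ... | inj₁ strong = p , col , record
        { #classes< = ℕ.≤-trans (s≤s (ℕ.m≤n+m p fuel)) (ℕ.≤-reflexive eq)
        ; refines = λ e → e ; strong = strong ; absorbs = λ _ m → m }
      ... | inj₂ (i , C , crossing , cheap) =
        let q , colour , r = refine fuel col′ (trans (ℕ.+-suc fuel p) eq) (col′-onto onto) (col′-cost cost)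
            open Refines r
        in q , colour , record
          { #classes< = #classes<
          ; refines = λ e → col′-coarse (refines e) ; strong = strong
          ; absorbs = λ s m → absorbs s (col′-absorbs s m) }
        where
        open Split col i C crossing cheap

      -- Starts from one class at cost zero; the result consists of the maximal strong sets of the
      -- whole graph.
      whole : 0 ℕ.< k → Fin n → ∃₂ λ q (colour : Fin n → Fin q) → Refines {Fin 1} (λ _ → zero) colour
      whole 0<k v = refine (k ℕ.∸ 1) (λ _ → zero) (ℕ.m∸n+n≡m 0<k) (λ { zero → v , refl })
        (subst₂ ℚ._<_ (sym (wt-∅ {bichromatic {1} (λ _ → zero)} (λ _ → refl))) (sym (ℚ.+-identityʳ u)) 0<u)

      -- Starts from the two sides of `A`; weight below `u + u` is the invariant of `refine` at
      -- `p = 2`.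
      twoSides : 2 ℕ.≤ k → ∀ {A} → IsCheapCut A → ∃₂ λ q (colour : Fin n → Fin q) → Refines A colour
      twoSides 2≤k {A} ((v , Av) , (w , Aw) , light) =
        let q , colour , r = refine (k ℕ.∸ 2) (side ∘ A) (ℕ.m∸n+n≡m 2≤k)
              (λ { zero → w , cong side Aw ; (suc zero) → v , cong side Av })
              (ℚ.≤-<-trans (wt-mono λ {e} h → boundary-intro {A} λ eq → bichromatic-elim (side ∘ A) {e} h (cong side eq))
                (subst (wt (boundary A) ℚ.<_) (cong (u ℚ.+_) (sym (ℚ.+-identityʳ u))) light))
            open Refines r
        in q , colour , record
          { #classes< = #classes< ; refines = λ e → side-injective _ _ (refines e) ; strong = strong
          ; absorbs = λ s m → absorbs s λ x y → cong side (m x y) }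

    -- Crossing two different classes costs at least `u` inside each, on disjoint sets of edges that
    -- all lie in the boundary of `B`.
    crosses-one-class : ∀ {A : Set} {f : Fin n → A} {p} {colour : Fin n → Fin p} → Refines f colour →
      ∀ {B} → wt (boundary B) ℚ.< u ℚ.+ u → ∀ {i j} → Crosses B (class colour i) → Crosses B (class colour j) → i ≡ j
    crosses-one-class {colour = colour} r {B} light {i} {j} cᵢ cⱼ with i Fin.≟ j
    ... | yes i≡j = i≡j
    ... | no  i≢j = contradiction (ℚ.≤-trans (ℚ.+-mono-≤ (strong i B cᵢ) (strong j B cⱼ))
          (wt-∪-disjoint {joins (class colour i ∩ B) (class colour i ∖ B)} {joins (class colour j ∩ B) (class colour j ∖ B)}
            (λ {e} h h′ → i≢j (trans (sym (class-elim colour (proj₁ (proj₁ (split-class {B} {class colour i} {e} h)))))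
                                          (class-elim colour (proj₁ (proj₁ (split-class {B} {class colour j} {e} h′))))))
            (λ {e} h → boundary-intro {B} {e} (proj₂ (split-class {B} {class colour i} h)))
            (λ {e} h → boundary-intro {B} {e} (proj₂ (split-class {B} {class colour j} h)))))
        (<⇒≱ℚ light)
      where open Refines r

-- Multiples of rationals, sizes of sets and further Boolean facts.

·-mono-≤ : ∀ m {p q} → p ℚ.≤ q → m · p ℚ.≤ m · q
·-mono-≤ zero    _   = ℚ.≤-refl
·-mono-≤ (suc m) p≤q = ℚ.+-mono-≤ p≤q (·-mono-≤ m p≤q)

·-mono-< : ∀ {m p q} → 0 ℕ.< m → p ℚ.< q → m · p ℚ.< m · q
·-mono-< {suc m} _ p<q = ℚ.+-mono-<-≤ p<q (·-mono-≤ m (ℚ.<⇒≤ p<q))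

·-nonNegative : ∀ m {p} → 0ℚ ℚ.≤ p → 0ℚ ℚ.≤ m · p
·-nonNegative zero    _   = ℚ.≤-refl
·-nonNegative (suc m) 0≤p = ℚ.+-mono-≤ 0≤p (·-nonNegative m 0≤p)

+-cancelˡ-≤ : ∀ r {p q} → r ℚ.+ p ℚ.≤ r ℚ.+ q → p ℚ.≤ q
+-cancelˡ-≤ r {p} {q} h = subst₂ ℚ._≤_ (lem r p) (lem r q) (ℚ.+-monoʳ-≤ (ℚ.- r) h)
  where
  open +-*-Solver
  lem : ∀ r p → ℚ.- r ℚ.+ (r ℚ.+ p) ≡ p
  lem = solve 2 (λ r p → :- r :+ (r :+ p) := p) refl

lookup-injective : ∀ {n} {S T : Subset n} → (∀ v → lookup S v ≡ lookup T v) → S ≡ T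
lookup-injective {S = S} {T} h = trans (sym (tabulate∘lookup S)) (trans (tabulate-cong h) (tabulate∘lookup T))

size : ∀ {n} → VSet n → ℕ
size P = ∣ tabulate P ∣

size-< : ∀ {n} {P Q : VSet n} → (∀ {v} → P v ≡ true → Q v ≡ true) → ∀ {w} → Q w ≡ true → P w ≡ false → size P ℕ.< size Q
size-< {P = P} {Q} P⊆Q {w} Qw Pw = p⊂q⇒∣p∣<∣q∣ {p = tabulate P} {tabulate Q}
  ( (λ {v} v∈P → lookup⇒[]= v _ (trans (lookup∘tabulate Q v)
      (P⊆Q (trans (sym (lookup∘tabulate P v)) ([]=⇒lookup v∈P)))))
  , w , lookup⇒[]= w _ (trans (lookup∘tabulate Q w) Qw)
  , λ w∈P → true≢false (trans (sym ([]=⇒lookup w∈P)) (trans (lookup∘tabulate P w) Pw)))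

∈-remove : ∀ {A : Set} (xs : List A) {ys v w} → w ∈ xs ++ v ∷ ys → w ≢ v → w ∈ xs ++ ys
∈-remove xs w∈ w≢v with ∈-++⁻ xs w∈
... | inj₁ w∈xs         = ∈-++⁺ˡ w∈xs
... | inj₂ (here eq)    = contradiction eq w≢v
... | inj₂ (there w∈ys) = ∈-++⁺ʳ xs w∈ys

¬true⇒false : ∀ {a} → a ≢ true → a ≡ false
¬true⇒false {false} _  = refl
¬true⇒false {true}  ne = contradiction refl ne

¬¬-true : ∀ {a} → ¬ (a ≢ true) → a ≡ true
¬¬-true {true}  _  = refl
¬¬-true {false} nn = contradiction (λ ()) nn

∨-elim : ∀ a {b} → a ∨ b ≡ true → a ≡ true ⊎ b ≡ true
∨-elim true  _ = inj₁ refl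
∨-elim false h = inj₂ h

xor-cancel : ∀ a b c → a xor c ≡ b xor c → a ≡ b
xor-cancel true  true  _     _ = refl
xor-cancel false false _     _ = refl
xor-cancel true  false true  ()
xor-cancel true  false false ()
xor-cancel false true  true  ()
xor-cancel false true  false ()

xor-one-of : ∀ {a b} c → a ≢ b → a xor c ≡ true ⊎ b xor c ≡ true
xor-one-of {true}  {true}  _     ne = contradiction refl ne
xor-one-of {false} {false} _     ne = contradiction refl ne
xor-one-of {true}  {false} true  _ = inj₂ refl
xor-one-of {true}  {false} false _ = inj₁ refl
xor-one-of {false} {true}  true  _ = inj₁ refl
xor-one-of {false} {true}  false _ = inj₂ refl

-- Light cuts and families of them.

module LightCuts {n : ℕ} (G : Graph n) (k : ℕ) (2≤k : 2 ℕ.≤ k) (u : ℚ) (0<u : 0ℚ ℚ.< u)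
  (k-colouring : (col : Fin n → Fin k) → (∀ i → ∃ λ v → col v ≡ i) → k · u ℚ.≤ Weights.wt G (Weights.bichromatic G col))
  (m : ℕ) (0<m : 0 ℕ.< m) where

  open Graph G
  open Weights G
  open Decompose k u 0<u k-colouring

  -- The inequality says that the boundary weighs at most `2u - u/m`, with the denominator cleared.
  IsLight : VSet n → Set
  IsLight A = IsCheapCut A × m · wt (boundary A) ℚ.+ u ℚ.≤ m · (u ℚ.+ u)

  isLight? : ∀ A → Dec (IsLight A)
  isLight? A = (Fin.any? (λ v → A v Bool.≟ true) ×-dec (Fin.any? (λ v → A v Bool.≟ false) ×-dec wt (boundary A) ℚ.<? (u ℚ.+ u)))
               ×-dec (_ ℚ.≤? _)

  -- Sets that are not light get a junk colouring with one colour.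
  abstract
    decomposition : ∀ (S : Subset n) → ∃₂ λ p (colour : Fin n → Fin p) → IsLight (lookup S) → Refines (lookup S) colour
    decomposition S with isLight? (lookup S)
    ... | yes light = let p , colour , r = twoSides 2≤k (proj₁ light) in p , colour , λ _ → r
    ... | no  ¬light = 1 , (λ _ → zero) , λ light → contradiction light ¬light

  #col : Subset n → ℕ
  #col S = proj₁ (decomposition S)

  col : (S : Subset n) → Fin n → Fin (#col S)
  col S = proj₁ (proj₂ (decomposition S))

  -- As many as `4m` disjoint petals, each joined to the core by weight at least `u/2m`, carry
  -- weight `2u`, too much for one light cut. In the recursion below a core either is all of the cut
  -- inside the class, or is enlarged in at most `petalLimit * k` ways.
  petalLimit branching : ℕ
  petalLimit = m ℕ.* 4
  branching  = 1 ℕ.+ petalLimit ℕ.* k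

  module Family (xs : List (Subset n)) (light : ∀ {S} → S ∈ xs → IsLight (lookup S)) where

    col-refines : ∀ {S} → S ∈ xs → Refines (lookup S) (col S)
    col-refines {S} S∈ = proj₂ (proj₂ (decomposition S)) (light S∈)

    cheap : ∀ {S} → S ∈ xs → wt (boundary (lookup S)) ℚ.< u ℚ.+ u
    cheap S∈ = proj₂ (proj₂ (proj₁ (light S∈)))

    infix 4 _∼_
    _∼_ : Fin n → Fin n → Set
    v ∼ w = All (λ S → lookup S v ≡ lookup S w) xs

    _∼?_ : ∀ v w → Dec (v ∼ w)
    v ∼? w = All.all? (λ S → lookup S v Bool.≟ lookup S w) xs

    Crossed : VSet n → Set
    Crossed Z = Any (λ B → Crosses (lookup B) Z) xs

    crossed? : ∀ Z → Dec (Crossed Z)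
    crossed? Z = Any.any? (λ B → crosses? (lookup B) Z) xs

    uncrossed⇒∼ : ∀ {Z} → ¬ Crossed Z → ∀ {v w} → Z v ≡ true → Z w ≡ true → v ∼ w
    uncrossed⇒∼ {Z} ¬cr Zv Zw = All.map (λ {B} ¬c → uncrossed {C = lookup B} {Z} ¬c Zv Zw) (All.¬Any⇒All¬ xs ¬cr)

    module Pattern {A} (A∈ : A ∈ xs) where

      -- A code for `B` by classes of `A`, faithful on every class that `B` does not cross.
      patternOf : Subset n → Subset (#col A)
      patternOf B = tabulate λ c → does (Fin.any? λ v → col A v Fin.≟ c ×-dec lookup B v Bool.≟ true)

      patternOf-correct : ∀ {B v} → (∀ {w} → col A w ≡ col A v → lookup B w ≡ lookup B v) →
                          lookup B v ≡ lookup (patternOf B) (col A v)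
      patternOf-correct {B} {v} h = trans (eq (lookup B v) refl) (sym (lookup∘tabulate _ (col A v)))
        where
        any-true? = Fin.any? λ w → col A w Fin.≟ col A v ×-dec lookup B w Bool.≟ true
        eq : ∀ b → lookup B v ≡ b → b ≡ does any-true?
        eq true  Bv = sym (dec-true any-true? (v , refl , Bv))
        eq false Bv = sym (dec-false any-true? λ (w , same , Bw) → true≢false (trans (sym Bw) (trans (h same) Bv)))

      -- Each member is then a union of classes of `A`, hence determined by its pattern.
      card-measurable : (∀ i → ¬ Crossed (class (col A) i)) → Card≤ (2 ℕ.^ #col A ℕ.* 1) (_∈ xs)
      card-measurable ¬cr = card-Subset (#col A) {λ t B → ∀ v → lookup B v ≡ lookup t (col A v)}
        (λ {B} B∈ → patternOf B , λ v → patternOf-correct {B} λ {w} same →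
          All.lookup (uncrossed⇒∼ (¬cr (col A v)) (class-intro (col A) same) (class-intro (col A) refl)) B∈)
        (λ t → card-subsingleton λ p q → lookup-injective λ v → trans (p v) (sym (q v)))

    -- A crossed class of least size.

    module MinimalClass {A} (A∈ : A ∈ xs) (i : Fin (#col A))
      (minimal : ∀ {B} → B ∈ xs → ∀ j → size (class (col B) j) ℕ.< size (class (col A) i) → ¬ Crossed (class (col B) j)) where

      open Pattern A∈

      private
        module RA = Refines (col-refines A∈)

      Z : VSet n
      Z = class (col A) i

      -- The positive side is `B` for `b = false` and its complement for `b = true`. A class of `B`
      -- containing a positive vertex of `Z` is separated by no member, so for `B` in the family
      -- this side of `Z` falls into fewer than `k` classes of `_∼_`.
      Sided : Bool → Subset n → Set
      Sided b B = ∀ {v w} → Z v ≡ true → lookup B v xor b ≡ true → col B v ≡ col B w → v ∼ w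

      AgreesOutside : Subset (#col A) → Subset n → Set
      AgreesOutside t B = ∀ {v} → Z v ≡ false → lookup B v ≡ lookup t (col A v)

      -- The class `Y` of `v` is strong and on one side of `A`, so it is absorbed by a class of `A`,
      -- namely `Z`. It lies on one side of `B` whereas `Z` meets both; hence it is smaller than
      -- `Z`, and minimality leaves it uncrossed.
      uncrossedByA⇒∼ : ∀ {B} → B ∈ xs → Crosses (lookup B) Z → ∀ {v w} → Z v ≡ true → col B v ≡ col B w →
                       ¬ Crosses (lookup A) (class (col B) (col B v)) → v ∼ w
      uncrossedByA⇒∼ {B} B∈ (x , y , (Zx , Bx) , (Zy , By)) {v} {w} Zv same ¬cr =
        uncrossed⇒∼ (minimal B∈ (col B v) (smaller (lookup B v) refl))
          (class-intro (col B) refl) (class-intro (col B) (sym same))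
        where
        module RB = Refines (col-refines B∈)
        Y = class (col B) (col B v)
        Y⊆Z : ∀ {z} → Y z ≡ true → Z z ≡ true
        Y⊆Z Yz = class-intro (col A)
          (trans (RA.absorbs (RB.strong (col B v)) (λ a b → uncrossed {C = lookup A} {Y} ¬cr a b) Yz (class-intro (col B) refl))
                 (class-elim (col A) Zv))
        outside : ∀ {z} → lookup B z ≢ lookup B v → Y z ≡ false
        outside ne = dec-false (col B _ Fin.≟ col B v) λ eq → ne (RB.refines eq)
        smaller : ∀ b → lookup B v ≡ b → size Y ℕ.< size Z
        smaller true  Bv = size-< {P = Y} {Z} Y⊆Z Zy (outside λ eq → true≢false (trans (sym Bv) (trans (sym eq) By)))
        smaller false Bv = size-< {P = Y} {Z} Y⊆Z Zx (outside λ eq → true≢false (trans (sym Bx) (trans eq Bv)))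

      -- `A` crosses at most one class of `B`, and that class lies on one side of `B`; the other
      -- side serves.
      sided : ∀ {B} → B ∈ xs → Crosses (lookup B) Z → ∃ λ b → Sided b B
      sided {B} B∈ cr with Fin.any? (λ y → crosses? (lookup A) (class (col B) (col B y)))
      -- Here both sides would do, and `true` is an arbitrary choice.
      ... | no none = true , λ {v} Zv _ same → uncrossedByA⇒∼ B∈ cr Zv same λ c → none (v , c)
      -- The choice `b = lookup B y` makes the side not containing `y` positive.
      ... | yes (y , cy) = lookup B y , λ {v} Zv Jv same → uncrossedByA⇒∼ B∈ cr Zv same λ c →
        true≢false (trans (sym Jv) (trans (cong (_xor lookup B y)
          (RB.refines (crosses-one-class (col-refines B∈) (cheap A∈) c cy))) (Bool.xor-same (lookup B y))))
        where module RB = Refines (col-refines B∈)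

      -- Since `B` crosses `Z`, it crosses no other class of `A`, so its pattern is faithful off
      -- `Z`.
      agreesOutside : ∀ {B} → B ∈ xs → Crosses (lookup B) Z → AgreesOutside (patternOf B) B
      agreesOutside {B} B∈ cr {v} Zv = patternOf-correct {B} λ {w} same →
        uncrossed {C = lookup B} {class (col A) (col A v)}
          (λ c → true≢false (trans (sym (class-intro (col A) {i} (sym (crosses-one-class (col-refines A∈) (cheap B∈) cr c)))) Zv))
          (class-intro (col A) same) (class-intro (col A) refl)

      -- The sunflower argument.

      module Sunflower (b : Bool) (t : Subset (#col A)) (x₀ : Fin n) (Zx₀ : Z x₀ ≡ true) where

        private
          whole₀ = whole (ℕ.<-≤-trans (s≤s z≤n) 2≤k) x₀
          colour₀ = proj₁ (proj₂ whole₀)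
          module R₀ = Refines (proj₂ (proj₂ whole₀))

        -- The maximal strong set around `x₀`: both `U` and a petal will split it, at cost at least
        -- `u` each.
        X : VSet n
        X = class colour₀ (colour₀ x₀)

        Z⊆X : ∀ {v} → Z v ≡ true → X v ≡ true
        Z⊆X Zv = class-intro colour₀ (R₀.absorbs (RA.strong i) (λ _ _ → refl) Zv Zx₀)

        -- b flips B so that the side made of few uncrossed classes is always the positive one.
        flipped inside : Subset n → VSet n
        flipped B v = lookup B v xor b
        inside B = Z ∩ flipped B

        Member : List (Fin n) → Subset n → Set
        Member cs B = B ∈ xs × Sided b B × AgreesOutside t B × All (λ c → inside B c ≡ true) cs

        -- The family cannot tell these vertices from those of `cs`, so every `Member cs` has all of
        -- them on its positive side.
        core : List (Fin n) → VSet n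
        core cs v = Z v ∧ does (Any.any? (_∼? v) cs)

        core⊆inside : ∀ {cs B} → Member cs B → ∀ {v} → core cs v ≡ true → inside B v ≡ true
        core⊆inside {cs} {B} (B∈ , _ , _ , cs⊆) {v} h =
          let Zv , near = ∧-elim h
              inside-c , c∼v = All.lookupAny cs⊆ (from-does (Any.any? (_∼? v) cs) near)
          in ∧-intro Zv (trans (cong (_xor b) (sym (All.lookup c∼v B∈))) (proj₂ (∧-elim inside-c)))

        petal : List (Fin n) → Subset n → VSet n
        petal cs B = inside B ∖ core cs

        petal-elim : ∀ cs B {v} → petal cs B v ≡ true → Z v ≡ true × flipped B v ≡ true × core cs v ≡ false
        petal-elim cs B {v} h =
          let Jv , ¬core = ∧-elim {inside B v} h ; Zv , Fv = ∧-elim {Z v} Jv in Zv , Fv , not-elim ¬core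

        -- The trace on X of a flipped member without its petal: it depends on cs and t only.
        rest : List (Fin n) → VSet n
        rest cs v = X v ∧ (if Z v then core cs v else lookup t (col A v) xor b)

        -- By `Sided`, two elements of `cs` with the same colour under `col B` would be related by
        -- `_∼_`. So the colours are distinct, and there are fewer than `k` of them.
        short : ∀ {cs B} → Member cs B → AllPairs (λ c d → ¬ c ∼ d) cs → length cs ℕ.< k
        short {cs} {B} (B∈ , side-B , _ , cs⊆) apart = ℕ.≤-<-trans
          (subst (length cs ℕ.≤_) (ℕ.*-identityʳ (#col B)) (subst (ℕ._≤ #col B ℕ.* 1) (List.length-map (col B) cs)
            (card-Fin {P = λ _ → B ∈ xs} (#col B) {λ c d → d ≡ c} (λ _ → _ , refl) (λ c → card-subsingleton λ p q → trans p (sym q))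
              (map (col B) cs) (distinct cs⊆ apart) (All.universal (λ _ → B∈) _))))
          (Refines.#classes< (col-refines B∈))
          where
          distinct : ∀ {cs} → All (λ c → inside B c ≡ true) cs → AllPairs (λ c d → ¬ c ∼ d) cs → Unique (map (col B) cs)
          distinct []       []             = []
          distinct (p ∷ ps) (c≁ ∷ apart) =
            All.map⁺ (All.map (λ ≁ eq → ≁ (side-B (proj₁ (∧-elim p)) (proj₂ (∧-elim p)) eq)) c≁) ∷ distinct ps apart

        -- One level of the recursion: `extend` is the induction hypothesis for cores with one
        -- further vertex.
        module Step (cs : List (Fin n)) (x₀∈cs : x₀ ∈ cs) (apart : AllPairs (λ c d → ¬ c ∼ d) cs)
          {bound} (extend : ∀ {c} → All (λ d → ¬ c ∼ d) cs → Card≤ bound (Member (c ∷ cs))) where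

          U : VSet n
          U = rest cs

          Petaled : Subset n → Set
          Petaled B = Member cs B × ∃ λ v → petal cs B v ≡ true

          U-in-Z : ∀ {v} → Z v ≡ true → U v ≡ X v ∧ core cs v
          U-in-Z {v} Zv = cong (λ z → X v ∧ (if z then core cs v else lookup t (col A v) xor b)) Zv

          U-outside-Z : ∀ {v} → Z v ≡ false → U v ≡ X v ∧ (lookup t (col A v) xor b)
          U-outside-Z {v} Zv = cong (λ z → X v ∧ (if z then core cs v else lookup t (col A v) xor b)) Zv

          core⊆U : ∀ {v} → core cs v ≡ true → U v ≡ true
          core⊆U cv = let Zv = proj₁ (∧-elim cv) in trans (U-in-Z Zv) (∧-intro (Z⊆X Zv) cv)

          U∩Z⊆core : ∀ {v} → Z v ≡ true → U v ≡ true → core cs v ≡ true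
          U∩Z⊆core {v} Zv Uv = proj₂ (∧-elim {X v} (trans (sym (U-in-Z Zv)) Uv))

          x₀∈core : core cs x₀ ≡ true
          x₀∈core = ∧-intro Zx₀ (dec-true (Any.any? (_∼? x₀) cs) (Any.map (λ { refl → All.universal (λ _ → refl) xs }) x₀∈cs))

          module _ {B} (M : Member cs B) where

            private
              outside : ∀ {v} → Z v ≡ false → lookup t (col A v) xor b ≡ flipped B v
              outside Zv = cong (_xor b) (sym (proj₁ (proj₂ (proj₂ M)) Zv))

            U⊆flipped : ∀ {v} → U v ≡ true → flipped B v ≡ true
            U⊆flipped {v} Uv = by (Z v) refl
              where
              by : ∀ z → Z v ≡ z → flipped B v ≡ true
              by true  Zv = proj₂ (∧-elim (core⊆inside M (U∩Z⊆core Zv Uv)))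
              by false Zv = trans (sym (outside Zv)) (proj₂ (∧-elim (trans (sym (U-outside-Z Zv)) Uv)))

            flipped⊆ : ∀ {v} → X v ≡ true → flipped B v ≡ true → petal cs B v ≡ false → U v ≡ true
            flipped⊆ {v} Xv Fv Pv = by (Z v) refl
              where
              by : ∀ z → Z v ≡ z → U v ≡ true
              by false Zv = trans (U-outside-Z Zv) (∧-intro Xv (trans (outside Zv) Fv))
              by true  Zv = ¬¬-true λ ¬Uv → true≢false (trans
                (sym (∧-intro (∧-intro Zv Fv) (not-intro (¬true⇒false λ cv → ¬Uv (core⊆U cv))))) Pv)

            boundary-flipped : ∀ {e v w} → (v ≡ src e × w ≡ tgt e) ⊎ (v ≡ tgt e × w ≡ src e) →
                               flipped B v ≡ true → flipped B w ≡ false → boundary (lookup B) e ≡ true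
            boundary-flipped ends Fv Fw = boundary-intro {lookup B} λ eq → true≢false (trans (sym Fv) (trans (cong (_xor b) (lemma ends eq)) Fw))
              where
              lemma : ∀ {e v w} → (v ≡ src e × w ≡ tgt e) ⊎ (v ≡ tgt e × w ≡ src e) →
                      lookup B (src e) ≡ lookup B (tgt e) → lookup B v ≡ lookup B w
              lemma (inj₁ (refl , refl)) eq = eq
              lemma (inj₂ (refl , refl)) eq = sym eq

            joins-boundary : ∀ {P Q e} → (∀ {v} → P v ≡ true → flipped B v ≡ true) → (∀ {v} → Q v ≡ true → flipped B v ≡ false) →
                             joins P Q e ≡ true → boundary (lookup B) e ≡ true
            joins-boundary {P} {Q} {e} P⊆ Q⊆ h with joins-cases {P} {Q} {e} h
            ... | inj₁ (p , q) = boundary-flipped (inj₁ (refl , refl)) (P⊆ p) (Q⊆ q)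
            ... | inj₂ (p , q) = boundary-flipped (inj₂ (refl , refl)) (P⊆ p) (Q⊆ q)

          -- In the induced subgraph on X both U and the petal P have boundary at least u,
          -- whereas U ∪ P has boundary less than 2u - u/m, being the trace of a light cut.
          petal-attached : ∀ {B} → Petaled B → u ℚ.≤ m · (wt (joins U (petal cs B)) ℚ.+ wt (joins U (petal cs B)))
          petal-attached {B} (M@(B∈ , _) , p , Pp) = +-cancelˡ-≤ (m · d) (ℚ.≤-trans (proj₂ (light B∈))
              (ℚ.≤-trans (·-mono-≤ m (ℚ.≤-trans both (ℚ.≤-reflexive (rearrange w r₁ r₂))))
              (ℚ.≤-trans (·-mono-≤ m (ℚ.+-monoˡ-≤ (w ℚ.+ w) ends)) (ℚ.≤-reflexive (×-distrib-+ d (w ℚ.+ w) m)))))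
            where
            P = petal cs B
            R₁ = (X ∖ U) ∖ P
            R₂ = (X ∖ P) ∖ U
            d = wt (boundary (lookup B))
            w = wt (joins U P)
            r₁ = wt (joins U R₁)
            r₂ = wt (joins P R₂)
            P⊆X : ∀ {v} → P v ≡ true → X v ≡ true
            P⊆X Pv = Z⊆X (proj₁ (∧-elim (proj₁ (∧-elim Pv))))
            P∩U : ∀ {v} → P v ≡ true → U v ≡ false
            P∩U Pv = ¬true⇒false λ Uv → true≢false
              (trans (sym (U∩Z⊆core (proj₁ (∧-elim (proj₁ (∧-elim Pv)))) Uv)) (not-elim (proj₂ (∧-elim Pv))))
            Ux₀ = core⊆U x₀∈core
            Px₀ : P x₀ ≡ false
            Px₀ = ¬true⇒false λ Px → true≢false (trans (sym Ux₀) (P∩U Px))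
            X∖U∖P-false : ∀ {v} → X v ≡ true → U v ≡ false → P v ≡ false → flipped B v ≡ false
            X∖U∖P-false Xv Uv Pv = ¬true⇒false λ Fv → true≢false (trans (sym (flipped⊆ M Xv Fv Pv)) Uv)
            R₁-false : ∀ {v} → R₁ v ≡ true → flipped B v ≡ false
            R₁-false Rv = let XU , ¬P = ∧-elim Rv ; Xv , ¬U = ∧-elim XU in X∖U∖P-false Xv (not-elim ¬U) (not-elim ¬P)
            R₂-false : ∀ {v} → R₂ v ≡ true → flipped B v ≡ false
            R₂-false Rv = let XP , ¬U = ∧-elim Rv ; Xv , ¬P = ∧-elim XP in X∖U∖P-false Xv (not-elim ¬U) (not-elim ¬P)
            P-true : ∀ {v} → P v ≡ true → flipped B v ≡ true
            P-true Pv = proj₁ (proj₂ (petal-elim cs B Pv))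
            apart′ : ∀ {e} → joins U R₁ e ≡ true → joins P R₂ e ≡ true → ⊥
            apart′ {e} h h′ with joins-cases {U} {R₁} {e} h | joins-cases {P} {R₂} {e} h′
            ... | inj₁ (a , _) | inj₁ (a′ , _) = true≢false (trans (sym a) (P∩U a′))
            ... | inj₂ (a , _) | inj₂ (a′ , _) = true≢false (trans (sym a) (P∩U a′))
            ... | inj₁ (_ , c) | inj₂ (a′ , _) = true≢false (trans (sym a′) (not-elim (proj₂ (∧-elim c))))
            ... | inj₂ (_ , c) | inj₁ (a′ , _) = true≢false (trans (sym a′) (not-elim (proj₂ (∧-elim c))))
            both : u ℚ.+ u ℚ.≤ (w ℚ.+ r₁) ℚ.+ (w ℚ.+ r₂)
            both = ℚ.+-mono-≤
              (ℚ.≤-trans (R₀.strong (colour₀ x₀) U (x₀ , p , (Z⊆X Zx₀ , Ux₀) , (P⊆X Pp , P∩U Pp)))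
                         (splitWeight-≤ X U P))
              (ℚ.≤-trans (R₀.strong (colour₀ x₀) P (p , x₀ , (P⊆X Pp , Pp) , (Z⊆X Zx₀ , Px₀)))
                         (ℚ.≤-trans (splitWeight-≤ X P U) (ℚ.+-monoˡ-≤ r₂ (wt-mono λ {e} → joins-sym {P} {U} {e}))))
            ends : r₁ ℚ.+ r₂ ℚ.≤ d
            ends = wt-∪-disjoint {joins U R₁} {joins P R₂} (λ {e} → apart′ {e})
              (λ {e} → joins-boundary M {U} {R₁} {e} (U⊆flipped M) R₁-false)
              (λ {e} → joins-boundary M {P} {R₂} {e} P-true R₂-false)
            rearrange : ∀ w r₁ r₂ → (w ℚ.+ r₁) ℚ.+ (w ℚ.+ r₂) ≡ (r₁ ℚ.+ r₂) ℚ.+ (w ℚ.+ w)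
            rearrange = solve 3 (λ w r₁ r₂ → (w :+ r₁) :+ (w :+ r₂) := (r₁ :+ r₂) :+ (w :+ w)) refl
              where open +-*-Solver

          -- `D` collects the `l` pairwise disjoint petals chosen so far, and the inequality says
          -- that they are joined to `U` by weight at least `l` times `u/2m`. Some remaining member
          -- supplies the next petal; each other one either meets it or goes to the recursive call.
          hits : ∀ fuel l D → l ℕ.+ fuel ≡ petalLimit →
            (∀ {v} → D v ≡ true → Z v ≡ true × core cs v ≡ false) →
            l · u ℚ.≤ m · (wt (joins U D) ℚ.+ wt (joins U D)) →
            Card≤ (fuel ℕ.* (k ℕ.* bound)) (λ B → Petaled B × (∀ {v} → petal cs B v ≡ true → D v ≡ false))
          -- A member whose petal avoids `D` has `U` on its positive and `D` on its negative side.
          -- It cuts all edges between them, so these weigh less than `2u`, against the accumulated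
          -- bound with `l = 4m`.
          hits zero l D full D⊆ heavy = card-∅ λ {B} ((M@(B∈ , _) , _) , disjoint) →
            let w = wt (joins U D)
                inD : ∀ {v} → D v ≡ true → flipped B v ≡ false
                inD Dv = let Zv , ¬core = D⊆ Dv in ¬true⇒false λ Fv →
                  true≢false (trans (sym Dv) (disjoint (∧-intro (∧-intro Zv Fv) (not-intro ¬core))))
                w<2u = ℚ.≤-<-trans (wt-mono λ {e} → joins-boundary M {U} {D} {e} (U⊆flipped M) inD) (cheap B∈)
            in <⇒≱ℚ (·-mono-< 0<m (ℚ.+-mono-< w<2u w<2u))
                 (subst (ℚ._≤ m · (w ℚ.+ w))
                   (trans (cong (_· u) (trans (sym (ℕ.+-identityʳ l)) full)) (trans (sym (×-assocˡ u m 4)) (cong (m ·_) (four u))))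
                   heavy)
            where
            four : ∀ u → 4 · u ≡ (u ℚ.+ u) ℚ.+ (u ℚ.+ u)
            four = solve 1 (λ u → u :+ (u :+ (u :+ (u :+ con 0ℚ))) := (u :+ u) :+ (u :+ u)) refl
              where open +-*-Solver
          hits (suc fuel) l D eq D⊆ heavy = card-if-inhabited λ {B} (pet@(M , _) , disjoint) →
            let P  = petal cs B
                D′ : VSet n
                D′ v = P v ∨ D v
            in card-⊎ {Q = λ B′ → Member cs B′ × ∃ λ v → petal cs B′ v ≡ true × P v ≡ true}
              (λ {B′} (pet′ , disjoint′) → meets? {B} {B′} pet′ disjoint′)
              (meet pet)
              (hits fuel (suc l) D′ (trans (sym (ℕ.+-suc l fuel)) eq) (λ {v} → D′⊆ {B} {v}) (heavier {B} pet disjoint))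
            where
            meets? : ∀ {B B′} → Petaled B′ → (∀ {v} → petal cs B′ v ≡ true → D v ≡ false) →
              (Member cs B′ × ∃ λ v → petal cs B′ v ≡ true × petal cs B v ≡ true) ⊎
              (Petaled B′ × (∀ {v} → petal cs B′ v ≡ true → petal cs B v ∨ D v ≡ false))
            meets? {B} {B′} pet′ disjoint′ with Fin.any? (λ v → petal cs B′ v Bool.≟ true ×-dec petal cs B v Bool.≟ true)
            ... | yes meet = inj₁ (proj₁ pet′ , meet)
            ... | no  none = inj₂ (pet′ , λ {v} Pv → cong₂ _∨_ (¬true⇒false λ Pv′ → none (v , Pv , Pv′)) (disjoint′ Pv))
            petal⊆ : ∀ {B v} → petal cs B v ≡ true → Z v ≡ true × core cs v ≡ false
            petal⊆ {B} Pv = let Zv , _ , ¬core = petal-elim cs B Pv in Zv , ¬core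
            D′⊆ : ∀ {B v} → petal cs B v ∨ D v ≡ true → Z v ≡ true × core cs v ≡ false
            D′⊆ {B} {v} h with ∨-elim (petal cs B v) h
            ... | inj₁ Pv = petal⊆ {B} Pv
            ... | inj₂ Dv = D⊆ Dv
            -- `U`, `D` and the new petal are pairwise disjoint, so no edge from `U` is counted
            -- twice.
            heavier : ∀ {B} → Petaled B → (∀ {v} → petal cs B v ≡ true → D v ≡ false) →
              let w′ = wt (joins U (λ v → petal cs B v ∨ D v)) in suc l · u ℚ.≤ m · (w′ ℚ.+ w′)
            heavier {B} pet disjoint = ℚ.≤-trans (ℚ.+-mono-≤ (petal-attached pet) heavy)
              (ℚ.≤-trans (ℚ.≤-reflexive (trans (sym (×-distrib-+ (wP ℚ.+ wP) (wD ℚ.+ wD) m)) (cong (m ·_) (rearrange wP wD))))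
                (·-mono-≤ m (ℚ.+-mono-≤ both both)))
              where
              P = petal cs B
              wP = wt (joins U P)
              wD = wt (joins U D)
              ∉U : ∀ {v} → Z v ≡ true × core cs v ≡ false → U v ≢ true
              ∉U (Zv , ¬core) Uv = true≢false (trans (sym (U∩Z⊆core Zv Uv)) ¬core)
              apart′ : ∀ {e} → joins U P e ≡ true → joins U D e ≡ true → ⊥
              apart′ {e} h h′ with joins-cases {U} {P} {e} h | joins-cases {U} {D} {e} h′
              ... | inj₁ (_ , p) | inj₁ (_ , d) = true≢false (trans (sym d) (disjoint p))
              ... | inj₂ (_ , p) | inj₂ (_ , d) = true≢false (trans (sym d) (disjoint p))
              ... | inj₁ (a , _) | inj₂ (_ , d) = ∉U (D⊆ d) a
              ... | inj₂ (a , _) | inj₁ (_ , d) = ∉U (D⊆ d) a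
              both = wt-∪-disjoint {joins U P} {joins U D} {joins U (λ v → P v ∨ D v)} (λ {e} → apart′ {e})
                (λ {e} → joins-monoʳ {U} {P} {λ v → P v ∨ D v} {e} λ {v} Pv → cong (_∨ D v) Pv)
                (λ {e} → joins-monoʳ {U} {D} {λ v → P v ∨ D v} {e} λ {v} Dv → trans (cong (P v ∨_) Dv) (Bool.∨-zeroʳ (P v)))
              rearrange : ∀ p d → (p ℚ.+ p) ℚ.+ (d ℚ.+ d) ≡ (p ℚ.+ d) ℚ.+ (p ℚ.+ d)
              rearrange = solve 2 (λ p d → (p :+ p) :+ (d :+ d) := (p :+ d) :+ (p :+ d)) refl
                where open +-*-Solver
            -- The petal of `B` meets fewer than `k` classes of `B`, and no member separates petal
            -- vertices of one class. So all members whose petals meet it in colour `c` contain one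
            -- fixed vertex `v₀`, which can join the core.
            meet : ∀ {B} → Petaled B → Card≤ (k ℕ.* bound) (λ B′ → Member cs B′ × ∃ λ v → petal cs B′ v ≡ true × petal cs B v ≡ true)
            meet {B} ((B∈ , side-B , _) , _) = card-mono (ℕ.*-monoˡ-≤ bound (ℕ.<⇒≤ (Refines.#classes< (col-refines B∈)))) (λ h → h)
              (card-Fin (#col B) {λ c B′ → Member cs B′ × ∃ λ v → (petal cs B′ v ≡ true × petal cs B v ≡ true) × col B v ≡ c}
                (λ (M′ , v , h) → col B v , M′ , v , h , refl)
                λ c → card-if-inhabited λ (_ , v₀ , (_ , Pv₀) , cv₀) →
                  card-mono ℕ.≤-refl (λ { {B′} ((B′∈ , side , out , cs⊆) , v , (P′v , Pv) , cv) →
                      let _ , F′v , _ = petal-elim cs B′ P′v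
                          v∼v₀ = side-B (proj₁ (petal⊆ {B} Pv)) (proj₁ (proj₂ (petal-elim cs B Pv))) (trans cv (sym cv₀))
                      in B′∈ , side , out ,
                         ∧-intro (proj₁ (petal⊆ {B} Pv₀)) (trans (cong (_xor b) (sym (All.lookup v∼v₀ B′∈))) F′v) ∷ cs⊆ })
                    -- `v₀` lies outside the core, hence is unrelated to every element of `cs`.
                    (extend (All.tabulate λ {d} d∈cs v₀∼d → true≢false (trans
                      (sym (∧-intro (proj₁ (petal⊆ {B} Pv₀))
                        (dec-true (Any.any? (_∼? v₀) cs) (Any.map (λ { refl → All.map sym v₀∼d }) d∈cs))))
                      (proj₂ (petal⊆ {B} Pv₀))))))

          -- A member without petal is determined by the core on `Z` and by `t` elsewhere, which
          -- gives the summand 1. The others are counted by `hits`, starting from no petals.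
          card-members : Card≤ (1 ℕ.+ petalLimit ℕ.* (k ℕ.* bound)) (Member cs)
          card-members = card-⊎ {Q = λ B → Member cs B × (∀ v → petal cs B v ≡ false)}
            (λ {B} → petaled? {B})
            (card-subsingleton λ {B} {B′} (M , none) (M′ , none′) → lookup-injective λ v → equal M none M′ none′ v (Z v) refl)
            (card-mono {Q = λ B → Petaled B × (∀ {v} → petal cs B v ≡ true → false ≡ false)} ℕ.≤-refl (λ pet → pet , λ _ → refl)
              (hits petalLimit 0 (λ _ → false) refl (λ ())
                (·-nonNegative m (ℚ.+-mono-≤ (wt≥0 (joins U (λ _ → false))) (wt≥0 (joins U (λ _ → false)))))))
            where
            petaled? : ∀ {B} → Member cs B → (Member cs B × (∀ v → petal cs B v ≡ false)) ⊎ Petaled B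
            petaled? {B} M with Fin.any? (λ v → petal cs B v Bool.≟ true)
            ... | yes pet = inj₂ (M , pet)
            ... | no none = inj₁ (M , λ v → ¬true⇒false λ Pv → none (v , Pv))
            equal : ∀ {B B′} → Member cs B → (∀ v → petal cs B v ≡ false) → Member cs B′ → (∀ v → petal cs B′ v ≡ false) →
                    ∀ v z → Z v ≡ z → lookup B v ≡ lookup B′ v
            equal (_ , _ , out , _) _ (_ , _ , out′ , _) _ v false Zv = trans (out Zv) (sym (out′ Zv))
            equal {B} {B′} M none M′ none′ v true Zv = xor-cancel (lookup B v) (lookup B′ v) b
              (trans (flipped-core M none) (sym (flipped-core M′ none′)))
              where
              flipped-core : ∀ {B} → Member cs B → (∀ v → petal cs B v ≡ false) → flipped B v ≡ core cs v
              flipped-core {B} M none with true-or-false (core cs v)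
              ... | inj₁ cv = trans (proj₂ (∧-elim (core⊆inside M cv))) (sym cv)
              ... | inj₂ ¬cv = trans (¬true⇒false λ Fv → true≢false (trans (sym (∧-intro (∧-intro Zv Fv) (not-intro ¬cv))) (none v)))
                                     (sym ¬cv)

        -- `s` is the number of vertices by which the core falls short of `k`. At `s = 0` there
        -- would be `k` pairwise unrelated core vertices, which `short` excludes.
        members : ∀ s cs → x₀ ∈ cs → AllPairs (λ c d → ¬ c ∼ d) cs → s ℕ.+ length cs ≡ k → Card≤ (branching ℕ.^ s) (Member cs)
        members zero    cs x₀∈cs apart eq = card-mono z≤n (λ M → M) (card-∅ λ M → ℕ.<-irrefl eq (short M apart))
        members (suc s) cs x₀∈cs apart eq = card-mono le (λ M → M) (Step.card-members cs x₀∈cs apart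
          λ {c} c-apart → members s (c ∷ cs) (there x₀∈cs) (c-apart ∷ apart) (trans (ℕ.+-suc s (length cs)) eq))
          where
          le : 1 ℕ.+ petalLimit ℕ.* (k ℕ.* branching ℕ.^ s) ℕ.≤ branching ℕ.* branching ℕ.^ s
          le = ℕ.+-mono-≤ (ℕ.m^n>0 branching s) (ℕ.≤-reflexive (sym (ℕ.*-assoc petalLimit k (branching ℕ.^ s))))

        card-through : Card≤ (branching ℕ.^ k) (Member (x₀ ∷ []))
        card-through = card-mono (ℕ.^-monoʳ-≤ branching (ℕ.m∸n≤m k 1)) (λ M → M)
          (members (k ℕ.∸ 1) (x₀ ∷ []) (here refl) ([] ∷ []) (ℕ.m∸n+n≡m (ℕ.<-≤-trans (s≤s z≤n) 2≤k)))

      -- Cuts that separate two vertices of the minimal class.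

      SidedBy : Bool → Fin n → Subset n → Set
      SidedBy b x B = B ∈ xs × Sided b B × Crosses (lookup B) Z × lookup B x xor b ≡ true

      -- One sunflower bound for each possible pattern `t` outside `Z`.
      card-sidedBy : ∀ b {x} → Z x ≡ true → Card≤ (2 ℕ.^ k ℕ.* branching ℕ.^ k) (SidedBy b x)
      card-sidedBy b {x} Zx = card-mono
        (ℕ.*-monoˡ-≤ (branching ℕ.^ k) (ℕ.^-monoʳ-≤ 2 (ℕ.<⇒≤ RA.#classes<))) (λ h → h)
        (card-Subset (#col A) {λ t B → Sunflower.Member b t x Zx (x ∷ []) B}
          (λ {B} (B∈ , side , cr , Bx) → patternOf B , B∈ , side , (λ {v} → agreesOutside B∈ cr {v}) , ∧-intro Zx Bx ∷ [])
          (λ t → Sunflower.card-through b t x Zx))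

      -- A separating member crosses `Z`, hence is sided for some `b`, and exactly one of `x` and
      -- `y` is on its positive side. The factor 4 counts these choices.
      card-separating : ∀ {x y} → Z x ≡ true → Z y ≡ true →
        Card≤ (4 ℕ.* (2 ℕ.^ k ℕ.* branching ℕ.^ k)) (λ B → B ∈ xs × lookup B x ≢ lookup B y)
      card-separating {x} {y} Zx Zy = card-Fin 4 {Q} classify bounds
        where
        Q : Fin 4 → Subset n → Set
        Q zero                   = SidedBy true x
        Q (suc zero)             = SidedBy true y
        Q (suc (suc zero))       = SidedBy false x
        Q (suc (suc (suc zero))) = SidedBy false y
        crossing : ∀ {B} → lookup B x ≢ lookup B y → Crosses (lookup B) Z
        crossing {B} ne with true-or-false (lookup B x)
        ... | inj₁ Bx  = x , y , (Zx , Bx) , (Zy , ¬true⇒false λ By → ne (trans Bx (sym By)))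
        ... | inj₂ ¬Bx = y , x , (Zy , ¬¬-true (λ ¬By → ne (trans ¬Bx (sym (¬true⇒false ¬By))))) , (Zx , ¬Bx)
        classify : ∀ {B} → B ∈ xs × lookup B x ≢ lookup B y → ∃ λ j → Q j B
        classify {B} (B∈ , ne) with sided B∈ (crossing {B} ne)
        classify {B} (B∈ , ne) | true , side with xor-one-of true ne
        ... | inj₁ h = zero , B∈ , side , crossing {B} ne , h
        ... | inj₂ h = suc zero , B∈ , side , crossing {B} ne , h
        classify {B} (B∈ , ne) | false , side with xor-one-of false ne
        ... | inj₁ h = suc (suc zero) , B∈ , side , crossing {B} ne , h
        ... | inj₂ h = suc (suc (suc zero)) , B∈ , side , crossing {B} ne , h
        bounds : ∀ j → Card≤ (2 ℕ.^ k ℕ.* branching ℕ.^ k) (Q j)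
        bounds zero                   = card-sidedBy true Zx
        bounds (suc zero)             = card-sidedBy true Zy
        bounds (suc (suc zero))       = card-sidedBy false Zx
        bounds (suc (suc (suc zero))) = card-sidedBy false Zy

    CrossedOfSize : ℕ → Set
    CrossedOfSize s = ∃ λ A → A ∈ xs × ∃ λ i → Crossed (class (col A) i) × size (class (col A) i) ≡ s

    crossedOfSize? : ∀ s → Dec (CrossedOfSize s)
    crossedOfSize? s with Any.any? (λ A → Fin.any? λ i → crossed? (class (col A) i) ×-dec (size (class (col A) i) ℕ.≟ s)) xs
    ... | yes any = yes (let A , A∈ , h = find any in A , A∈ , h)
    ... | no none = no λ (A , A∈ , h) → none (lose A∈ h)

    -- If no class is crossed, patterns over any one member count the family. Otherwise a member
    -- crossing a crossed class of least size provides `x` and `y`.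
    few-or-rarely-separated : Unique xs → length xs ℕ.≤ 2 ℕ.^ k ⊎
      ∃₂ λ x y → ¬ x ∼ y × Card≤ (4 ℕ.* (2 ℕ.^ k ℕ.* branching ℕ.^ k)) (λ B → B ∈ xs × lookup B x ≢ lookup B y)
    few-or-rarely-separated unique
      with Any.any? (λ A → Fin.any? λ i → crossed? (class (col A) i)) xs
    ... | no none = inj₁ (card-if-inhabited {P = _∈ xs}
          (λ {A} A∈ → card-mono (ℕ.≤-trans (ℕ.≤-reflexive (ℕ.*-identityʳ _))
              (ℕ.^-monoʳ-≤ 2 (ℕ.<⇒≤ (Refines.#classes< (col-refines A∈))))) (λ h → h)
            (Pattern.card-measurable A∈ λ i cr → none (lose A∈ (i , cr))))
          xs unique (All.tabulate λ h → h))
    ... | yes some with find some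
    ...   | A₀ , A₀∈ , i₀ , cr₀ with least crossedOfSize? (A₀ , A₀∈ , i₀ , cr₀ , refl)
    ...     | s , (A , A∈ , i , cr , refl) , smallest with find cr
    ...       | B , B∈ , x , y , (Zx , Bx) , (Zy , By) =
      inj₂ (x , y , (λ x∼y → true≢false (trans (sym Bx) (trans (All.lookup x∼y B∈) By))) ,
        MinimalClass.card-separating A∈ i (λ {B} B∈ j lt cr → smallest lt (B , B∈ , j , cr , refl)) Zx Zy)

  -- Induction on the number of vertex representatives.

  perVertex : ℕ
  perVertex = 4 ℕ.* (2 ℕ.^ k ℕ.* branching ℕ.^ k)

  Represents : List (Fin n) → List (Subset n) → Set
  Represents reps xs = ∀ v → ∃ λ r → r ∈ reps × All (λ S → lookup S v ≡ lookup S r) xs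

  card-light-reps : ∀ r (reps : List (Fin n)) → length reps ≡ r → (xs : List (Subset n)) → Unique xs →
    (∀ {S} → S ∈ xs → IsLight (lookup S)) → Represents reps xs → length xs ℕ.≤ 2 ℕ.^ k ℕ.+ r ℕ.* perVertex
  card-light-reps r reps len xs unique light represents
    with Family.few-or-rarely-separated xs light unique
  ... | inj₁ few = ℕ.≤-trans few (ℕ.m≤m+n _ _)
  ... | inj₂ (x , y , x≁y , rare) with represents x | represents y
  ...   | x′ , x′∈ , x∼x′ | y′ , y′∈ , y∼y′ with ∈-∃++ y′∈
  -- The list contains `y′`, so its length cannot be zero.
  card-light-reps zero _ () _ _ _ _ | inj₂ _ | _ | _ | [] , reps₂ , refl
  card-light-reps zero _ () _ _ _ _ | inj₂ _ | _ | _ | _ ∷ _ , reps₂ , refl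
  card-light-reps (suc r) reps len xs unique light represents
    | inj₂ (x , y , x≁y , rare) | x′ , x′∈ , x∼x′ | y′ , y′∈ , y∼y′ | reps₁ , reps₂ , refl =
      ℕ.≤-trans (ℕ.≤-reflexive (length-filter-split xs))
      (ℕ.≤-trans (ℕ.+-mono-≤ separated agreeing) (ℕ.≤-reflexive rearrange))
    where
    agrees? : ∀ S → Dec (lookup S x ≡ lookup S y)
    agrees? S = lookup S x Bool.≟ lookup S y
    xs₁ = filter (¬? ∘ agrees?) xs
    xs₂ = filter agrees? xs
    length-filter-split : ∀ xs → length xs ≡ length (filter (¬? ∘ agrees?) xs) ℕ.+ length (filter agrees? xs)
    length-filter-split []       = refl
    length-filter-split (S ∷ xs) with agrees? S
    ... | yes _ = trans (cong suc (length-filter-split xs)) (sym (ℕ.+-suc (length (filter (¬? ∘ agrees?) xs)) _))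
    ... | no  _ = cong suc (length-filter-split xs)
    separated : length xs₁ ℕ.≤ perVertex
    separated = rare xs₁ (filter⁺ (¬? ∘ agrees?) unique) (All.tabulate (∈-filter⁻ (¬? ∘ agrees?)))
    x′≢y′ : x′ ≢ y′
    x′≢y′ refl = x≁y (All.zipWith (λ (a , b) → trans a (sym b)) (x∼x′ , y∼y′))
    restrict : ∀ {P : Subset n → Set} → All P xs → All P xs₂
    restrict ps = All.tabulate λ S∈ → All.lookup ps (proj₁ (∈-filter⁻ agrees? S∈))
    represents′ : Represents (reps₁ ++ reps₂) xs₂
    represents′ v with represents v
    ... | r , r∈ , v∼r with r Fin.≟ y′
    ...   | no r≢y′  = r , ∈-remove reps₁ r∈ r≢y′ , restrict v∼r
    -- What `y′` represented passes to `x′`: the remaining members agree on `y′`, `y`, `x` and `x′`.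
    ...   | yes refl = x′ , ∈-remove reps₁ x′∈ x′≢y′ , All.tabulate λ S∈ → let S∈xs , agree = ∈-filter⁻ agrees? S∈ in
        trans (All.lookup v∼r S∈xs) (trans (sym (All.lookup y∼y′ S∈xs)) (trans (sym agree) (All.lookup x∼x′ S∈xs)))
    length′ : length (reps₁ ++ reps₂) ≡ r
    length′ = ℕ.suc-injective (trans (trans (cong suc (List.length-++ reps₁)) (sym (ℕ.+-suc (length reps₁) (length reps₂))))
      (trans (sym (List.length-++ reps₁)) len))
    agreeing : length xs₂ ℕ.≤ 2 ℕ.^ k ℕ.+ r ℕ.* perVertex
    agreeing = card-light-reps r (reps₁ ++ reps₂) length′ xs₂ (filter⁺ agrees? unique)
      (λ S∈ → light (proj₁ (∈-filter⁻ agrees? S∈))) represents′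
    rearrange : perVertex ℕ.+ (2 ℕ.^ k ℕ.+ r ℕ.* perVertex) ≡ 2 ℕ.^ k ℕ.+ (perVertex ℕ.+ r ℕ.* perVertex)
    rearrange = trans (sym (ℕ.+-assoc perVertex _ _)) (trans (cong (ℕ._+ r ℕ.* perVertex) (ℕ.+-comm perVertex (2 ℕ.^ k)))
      (ℕ.+-assoc (2 ℕ.^ k) perVertex _))

  card-light : Card≤ (2 ℕ.^ k ℕ.+ n ℕ.* perVertex) (λ S → IsLight (lookup S))
  card-light xs unique light = card-light-reps n (allFin n) (List.length-tabulate (λ i → i)) xs unique (All.lookup light)
    λ v → v , ∈-allFin v , All.universal (λ _ → refl) xs

-- Natural numbers among the rationals, and rounding.

ι : ℕ → ℚ
ι a = + a ℚ./ 1

private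
  toℚᵘ-ι : ∀ a → ℚ.toℚᵘ (ι a) ℚᵘ.≃ mkℚᵘ (+ a) 0
  toℚᵘ-ι a = ℚ.toℚᵘ-fromℚᵘ (mkℚᵘ (+ a) 0)

ι-+ : ∀ a b → ι (a ℕ.+ b) ≡ ι a ℚ.+ ι b
ι-+ a b = ℚ.toℚᵘ-injective (ℚᵘ.≃-trans (toℚᵘ-ι (a ℕ.+ b)) (ℚᵘ.≃-trans (*≡* eq)
  (ℚᵘ.≃-sym (ℚᵘ.≃-trans (ℚ.toℚᵘ-homo-+ (ι a) (ι b)) (ℚᵘ.+-cong (toℚᵘ-ι a) (toℚᵘ-ι b))))))
  where
  eq : + (a ℕ.+ b) ℤ.* + 1 ≡ (+ a ℤ.* + 1 ℤ.+ + b ℤ.* + 1) ℤ.* + 1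
  eq = cong (ℤ._* + 1) (cong₂ ℤ._+_ (sym (ℤ.*-identityʳ (+ a))) (sym (ℤ.*-identityʳ (+ b))))

ι-* : ∀ a b → ι (a ℕ.* b) ≡ ι a ℚ.* ι b
ι-* a b = ℚ.toℚᵘ-injective (ℚᵘ.≃-trans (toℚᵘ-ι (a ℕ.* b)) (ℚᵘ.≃-trans (*≡* (cong (ℤ._* + 1) (ℤ.pos-* a b)))
  (ℚᵘ.≃-sym (ℚᵘ.≃-trans (ℚ.toℚᵘ-homo-* (ι a) (ι b)) (ℚᵘ.*-cong (toℚᵘ-ι a) (toℚᵘ-ι b))))))

0≤ι : ∀ a → 0ℚ ℚ.≤ ι a
0≤ι a = ℚ.nonNegative⁻¹ (ι a) {{ℚ.normalize-nonNeg a 1}}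

ι-cancel : ∀ {a b} → ι a ℚ.≤ ι b → a ℕ.≤ b
ι-cancel {a} {b} le with ℚᵘ.≤-respˡ-≃ (toℚᵘ-ι a) (ℚᵘ.≤-respʳ-≃ (toℚᵘ-ι b) (ℚ.toℚᵘ-mono-≤ le))
... | ℚᵘ.*≤* h = ℤ.drop‿+≤+ (subst₂ ℤ._≤_ (ℤ.*-identityʳ (+ a)) (ℤ.*-identityʳ (+ b)) h)

ι-mono : ∀ {a b} → a ℕ.≤ b → ι a ℚ.≤ ι b
ι-mono {a} {b} a≤b = subst₂ ℚ._≤_ (ℚ.+-identityʳ (ι a))
  (trans (sym (ι-+ a (b ℕ.∸ a))) (cong ι (ℕ.m+[n∸m]≡n a≤b))) (ℚ.+-monoʳ-≤ (ι a) (0≤ι (b ℕ.∸ a)))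

·-ι : ∀ a x → a · x ≡ ι a ℚ.* x
·-ι zero    x = sym (ℚ.*-zeroˡ x)
·-ι (suc a) x = trans (cong₂ ℚ._+_ (sym (ℚ.*-identityˡ x)) (·-ι a x))
  (trans (sym (ℚ.*-distribʳ-+ x 1ℚ (ι a))) (cong (ℚ._* x) (sym (ι-+ 1 a))))

*-mono-≤ : ∀ {p q r s} → 0ℚ ℚ.≤ p → 0ℚ ℚ.≤ s → p ℚ.≤ q → r ℚ.≤ s → p ℚ.* r ℚ.≤ q ℚ.* s
*-mono-≤ {p} {q} {r} {s} 0≤p 0≤s p≤q r≤s = ℚ.≤-trans
  (ℚ.*-monoˡ-≤-nonNeg p {{ℚ.nonNegative 0≤p}} r≤s)
  (ℚ.*-monoʳ-≤-nonNeg s {{ℚ.nonNegative 0≤s}} p≤q)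

recip-inverseˡ : ∀ {p} → 0ℚ ℚ.< p → recip p ℚ.* p ≡ 1ℚ
recip-inverseˡ {p} 0<p with p ℚ.≟ 0ℚ
... | yes p≡0 = contradiction (sym p≡0) (ℚ.<⇒≢ 0<p)
... | no  p≢0 = ℚ.*-inverseˡ p {{ℚ.≢-nonZero p≢0}}

-- Take the floor plus one; it is at most `q + 1`, and `2 ≤ q` turns this into at most `q * q`. The
-- square lets powers of `m` be bounded by powers of `q` without a constant factor.
roundUp : ∀ {q} → ι 2 ℚ.≤ q → ∃ λ m → q ℚ.≤ ι m × ι m ℚ.≤ q ℚ.* q
roundUp {ℚ.mkℚ (ℤ.-[1+ a ]) d c} (ℚ.*≤* ())
roundUp {q@(ℚ.mkℚ (+ a) d c)} 2≤q = suc f , q≤m , ℚ.≤-trans m≤q+1 q+1≤q²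
  where
  f = a ℕ./ suc d
  den = suc d
  q≤m : q ℚ.≤ ι (suc f)
  q≤m = ℚ.toℚᵘ-cancel-≤ (ℚᵘ.≤-respʳ-≃ (ℚᵘ.≃-sym (toℚᵘ-ι (suc f)))
    (ℚᵘ.*≤* (subst₂ ℤ._≤_ (sym (ℤ.*-identityʳ (+ a))) (ℤ.pos-* (suc f) den)
      (ℤ.+≤+ (ℕ.≤-trans (ℕ.≤-reflexive (ℕ.m≡m%n+[m/n]*n a den))
        (ℕ.+-monoˡ-≤ (f ℕ.* den) (ℕ.<⇒≤ (ℕ.m%n<n a den))))))))
  f≤q : ι f ℚ.≤ q
  f≤q = ℚ.toℚᵘ-cancel-≤ (ℚᵘ.≤-respˡ-≃ (ℚᵘ.≃-sym (toℚᵘ-ι f))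
    (ℚᵘ.*≤* (subst₂ ℤ._≤_ (ℤ.pos-* f den) (sym (ℤ.*-identityʳ (+ a))) (ℤ.+≤+ (ℕ.m/n*n≤m a den)))))
  m≤q+1 : ι (suc f) ℚ.≤ q ℚ.+ 1ℚ
  m≤q+1 = ℚ.≤-trans (ℚ.≤-reflexive (trans (ι-+ 1 f) (ℚ.+-comm 1ℚ (ι f)))) (ℚ.+-monoˡ-≤ 1ℚ f≤q)
  q+1≤q² : q ℚ.+ 1ℚ ℚ.≤ q ℚ.* q
  q+1≤q² = ℚ.≤-trans (ℚ.+-monoʳ-≤ q (ℚ.≤-trans (ι-mono {1} {2} (s≤s z≤n)) 2≤q))
    (ℚ.≤-trans (ℚ.≤-reflexive (two* q)) (*-mono-≤ (0≤ι 2) (ℚ.≤-trans (0≤ι 2) 2≤q) 2≤q ℚ.≤-refl))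
    where
    two* : ∀ q → q ℚ.+ q ≡ ι 2 ℚ.* q
    two* = solve 1 (λ q → q :+ q := con (ι 2) :* q) refl
      where open +-*-Solver

-- Colourings as k-cuts, and the average weight.

module _ {n : ℕ} (G : Graph n) where
  open Graph G
  open Weights G

  totalWeight-tabulate : ∀ φ → totalWeight G (tabulate φ) ≡ wt φ
  totalWeight-tabulate φ = wt-cong (lookup∘tabulate φ)

  totalWeight-nonNegative : ∀ F → 0ℚ ℚ.≤ totalWeight G F
  totalWeight-nonNegative F = wt≥0 (lookup F)

  -- Every surviving edge joins vertices of one colour, so colour is constant on components and one
  -- vertex of each colour gives `k` distinct components.
  colouring⇒IsKCut : ∀ {k} (col : Fin n → Fin k) → (∀ i → ∃ λ v → col v ≡ i) → IsKCut G k (tabulate (bichromatic col))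
  colouring⇒IsKCut col onto = record
    { to        = λ i → proj₁ (onto i)
    ; cong      = λ { refl → EqClosure.reflexive _ }
    ; injective = λ {i} {j} connected → trans (sym (proj₂ (onto i)))
        (trans (EqClosure.gfold isEquivalence col same connected) (proj₂ (onto j)))
    }
    where
    F = tabulate (bichromatic col)
    same : ∀ {v w} → AdjacentAvoiding G F v w → col v ≡ col w
    same (e , e∉F , refl , refl) with col (src e) Fin.≟ col (tgt e)
    ... | yes eq = eq
    ... | no  ne = contradiction
      (lookup⇒[]= e F (trans (lookup∘tabulate (bichromatic col) e) (bichromatic-intro col ne))) e∉F

  k-colouring-weight : ∀ {k λₖ} → IsMinKCutWeight G k λₖ → (col : Fin n → Fin k) → (∀ i → ∃ λ v → col v ≡ i) →
                       λₖ ℚ.≤ wt (bichromatic col)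
  k-colouring-weight (_ , least) col onto =
    subst (_ ℚ.≤_) (totalWeight-tabulate (bichromatic col)) (least _ (colouring⇒IsKCut col onto))

·-average : ∀ q k .{{_ : NonZero k}} → k · average q k ≡ q
·-average q k@(suc k-1) = trans (·-ι k (average q k)) (trans (rearrange (ι k) q (ℤ.1ℤ ℚ./ k)) (trans (cong (q ℚ.*_) ι-inverse) (ℚ.*-identityʳ q)))
  where
  rearrange : ∀ a b c → a ℚ.* (b ℚ.* c) ≡ b ℚ.* (a ℚ.* c)
  rearrange = solve 3 (λ a b c → a :* (b :* c) := b :* (a :* c)) refl
    where open +-*-Solver
  ι-inverse : ι k ℚ.* (ℤ.1ℤ ℚ./ k) ≡ 1ℚ
  ι-inverse = ℚ.toℚᵘ-injective (ℚᵘ.≃-trans (ℚ.toℚᵘ-homo-* (ι k) (ℤ.1ℤ ℚ./ k))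
    (ℚᵘ.≃-trans (ℚᵘ.*-cong (toℚᵘ-ι k) (ℚ.toℚᵘ-fromℚᵘ (mkℚᵘ ℤ.1ℤ k-1)))
      (*≡* (cong +_ (eq k)))))
    where
    eq : ∀ k → k ℕ.* 1 ℕ.* 1 ≡ 1 ℕ.* (1 ℕ.* k)
    eq k = trans (ℕ.*-identityʳ _) (trans (ℕ.*-identityʳ k) (sym (trans (ℕ.*-identityˡ _) (ℕ.*-identityˡ k))))

-- Absorbing the constants into a power of `m`.

branching-bound : ∀ {k m} → 2 ℕ.≤ k → k ℕ.≤ m → 1 ℕ.+ m ℕ.* 4 ℕ.* k ℕ.≤ m ℕ.^ 5
branching-bound {k} {m} 2≤k k≤m = begin
  1 ℕ.+ m ℕ.* 4 ℕ.* k              ≤⟨ ℕ.+-mono-≤ 1≤4m² (ℕ.≤-trans (ℕ.*-monoʳ-≤ (m ℕ.* 4) k≤m) (ℕ.≤-reflexive swap)) ⟩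
  4 ℕ.* m² ℕ.+ 4 ℕ.* m²            ≡⟨ sym (ℕ.*-distribʳ-+ m² 4 4) ⟩
  2 ℕ.* (2 ℕ.* (2 ℕ.* 1)) ℕ.* m²   ≤⟨ ℕ.*-monoˡ-≤ m² (ℕ.^-monoˡ-≤ 3 2≤m) ⟩
  m ℕ.^ 3 ℕ.* m²                   ≡⟨ sym (ℕ.^-distribˡ-+-* m 3 2) ⟩
  m ℕ.^ 5                          ∎
  where
  open ℕ.≤-Reasoning
  m² = m ℕ.^ 2
  2≤m = ℕ.≤-trans 2≤k k≤m
  1≤4m² : 1 ℕ.≤ 4 ℕ.* m²
  1≤4m² = ℕ.≤-trans (ℕ.^-monoˡ-≤ 2 (ℕ.≤-trans (s≤s z≤n) 2≤m)) (ℕ.m≤n*m m² 4)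
  swap : m ℕ.* 4 ℕ.* m ≡ 4 ℕ.* m²
  swap = trans (cong (ℕ._* m) (ℕ.*-comm m 4)) (trans (ℕ.*-assoc 4 m m) (cong (λ x → 4 ℕ.* (m ℕ.* x)) (sym (ℕ.*-identityʳ m))))

-- In the exponent, `k` pays for the factor 4, `k` for `2 ^ k`, `5k` for the branching, and a last
-- `k` for adding the two terms.
size-bound : ∀ {k m n} → 2 ℕ.≤ k → k ℕ.≤ m → k ℕ.≤ n →
  2 ℕ.^ k ℕ.+ n ℕ.* (4 ℕ.* (2 ℕ.^ k ℕ.* (1 ℕ.+ m ℕ.* 4 ℕ.* k) ℕ.^ k)) ℕ.≤ m ℕ.^ (8 ℕ.* k) ℕ.* n
size-bound {k} {m} {n} 2≤k k≤m k≤n = begin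
  2 ℕ.^ k ℕ.+ n ℕ.* perVertex             ≤⟨ ℕ.+-mono-≤ small (ℕ.*-monoʳ-≤ n per) ⟩
  n ℕ.* m⁷ ℕ.+ n ℕ.* m⁷                   ≡⟨ cong (n ℕ.* m⁷ ℕ.+_) (sym (ℕ.+-identityʳ (n ℕ.* m⁷))) ⟩
  2 ℕ.* (n ℕ.* m⁷)                        ≤⟨ ℕ.*-monoˡ-≤ (n ℕ.* m⁷) (ℕ.≤-trans 2≤m m≤mᵏ) ⟩
  m ℕ.^ k ℕ.* (n ℕ.* m⁷)                  ≡⟨ cong (m ℕ.^ k ℕ.*_) (ℕ.*-comm n m⁷) ⟩
  m ℕ.^ k ℕ.* (m⁷ ℕ.* n)                  ≡⟨ sym (ℕ.*-assoc (m ℕ.^ k) m⁷ n) ⟩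
  m ℕ.^ k ℕ.* m⁷ ℕ.* n                    ≡⟨ cong (ℕ._* n) (sym (ℕ.^-distribˡ-+-* m k (7 ℕ.* k))) ⟩
  m ℕ.^ (8 ℕ.* k) ℕ.* n                   ∎
  where
  open ℕ.≤-Reasoning
  2≤m = ℕ.≤-trans 2≤k k≤m
  instance
    m≢0 : NonZero m
    m≢0 = ℕ.>-nonZero (ℕ.≤-trans (s≤s z≤n) 2≤m)
  m⁷ = m ℕ.^ (7 ℕ.* k)
  perVertex = 4 ℕ.* (2 ℕ.^ k ℕ.* (1 ℕ.+ m ℕ.* 4 ℕ.* k) ℕ.^ k)
  m≤mᵏ : m ℕ.≤ m ℕ.^ k
  m≤mᵏ = ℕ.≤-trans (ℕ.≤-reflexive (sym (ℕ.^-identityʳ m))) (ℕ.^-monoʳ-≤ m (ℕ.≤-trans (s≤s z≤n) 2≤k))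
  small : 2 ℕ.^ k ℕ.≤ n ℕ.* m⁷
  small = ℕ.≤-trans (ℕ.^-monoˡ-≤ k 2≤m) (ℕ.≤-trans (ℕ.^-monoʳ-≤ m (ℕ.m≤n*m k 7))
    (ℕ.≤-trans (ℕ.≤-reflexive (sym (ℕ.*-identityˡ m⁷))) (ℕ.*-monoˡ-≤ m⁷ (ℕ.≤-trans (s≤s z≤n) (ℕ.≤-trans 2≤k k≤n)))))
  per : perVertex ℕ.≤ m⁷
  per = begin
    4 ℕ.* (2 ℕ.^ k ℕ.* (1 ℕ.+ m ℕ.* 4 ℕ.* k) ℕ.^ k)
      ≤⟨ ℕ.*-mono-≤ (ℕ.≤-trans (ℕ.^-monoˡ-≤ 2 2≤m) (ℕ.^-monoʳ-≤ m 2≤k))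
           (ℕ.*-mono-≤ (ℕ.^-monoˡ-≤ k 2≤m) (ℕ.^-monoˡ-≤ k (branching-bound 2≤k k≤m))) ⟩
    m ℕ.^ k ℕ.* (m ℕ.^ k ℕ.* (m ℕ.^ 5) ℕ.^ k)
      ≡⟨ cong (λ x → m ℕ.^ k ℕ.* (m ℕ.^ k ℕ.* x)) (ℕ.^-*-assoc m 5 k) ⟩
    m ℕ.^ k ℕ.* (m ℕ.^ k ℕ.* m ℕ.^ (5 ℕ.* k))
      ≡⟨ cong (m ℕ.^ k ℕ.*_) (sym (ℕ.^-distribˡ-+-* m k (5 ℕ.* k))) ⟩
    m ℕ.^ k ℕ.* m ℕ.^ (6 ℕ.* k)
      ≡⟨ sym (ℕ.^-distribˡ-+-* m k (6 ℕ.* k)) ⟩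
    m ℕ.^ (7 ℕ.* k) ∎

-- Each factor `m` is paid for by two factors `seq x i`.
power-bound : ∀ (x : ℝ) i {m} → ι m ℚ.≤ seq x i ℚ.* seq x i → ∀ j → ι (m ℕ.^ j) ℚ.≤ seq (x ^ (j ℕ.* 2)) i
power-bound x i         m≤q² zero    = ℚ.≤-refl
power-bound x i {m = m} m≤q² (suc j) = ℚ.≤-trans (ℚ.≤-reflexive (ι-* m (m ℕ.^ j)))
  (ℚ.≤-trans (*-mono-≤ (0≤ι m) (ℚ.≤-trans (0≤ι (m ℕ.^ j)) IH) m≤q² IH)
    (ℚ.≤-reflexive (ℚ.*-assoc (seq x i) (seq x i) _)))
  where IH = power-bound x i m≤q² j

proper : ∀ {n} {S : Subset n} → IsCut S → (∃ λ v → lookup S v ≡ true) × (∃ λ v → lookup S v ≡ false)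
proper ((v , v∈S) , _ , w , _ , w∉S) = (v , []=⇒lookup v∈S) , w , ¬true⇒false (w∉S ∘ lookup⇒[]= w _)

-- Cuts below a rational multiple of the average.

module _ {n : ℕ} (G : Graph n) where
  open Graph G
  open Weights G

  card-cheap-cuts : ∀ {k} .{{_ : NonZero k}} → 2 ℕ.≤ k → k ℕ.≤ n → ∀ {λₖ} → IsMinKCutWeight G k λₖ →
    ∀ {g} → 0ℚ ℚ.< ι 2 ℚ.- g → ∀ {m} → k ℕ.≤ m → recip (ι 2 ℚ.- g) ℚ.≤ ι m →
    Card≤ (m ℕ.^ (8 ℕ.* k) ℕ.* n) (λ S → IsCut S × totalWeight G (∂ G S) ℚ.< g ℚ.* average λₖ k)
  -- Positivity of `u` comes from a cheap cut itself: its nonnegative weight lies below `g * u`.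
  card-cheap-cuts {k} 2≤k k≤n {λₖ} min {g} 0<2-g {m} k≤m recip≤m = card-if-inhabited λ {S} (_ , cheap) →
    let 0<u = positive-average S cheap in
    card-mono (size-bound 2≤k k≤m k≤n) (light 0<u)
      (LightCuts.card-light G k 2≤k u 0<u k-colouring m 0<m)
    where
    u = average λₖ k
    h = ι 2 ℚ.- g
    k-colouring : (col : Fin n → Fin k) → (∀ i → ∃ λ v → col v ≡ i) → k · u ℚ.≤ wt (bichromatic col)
    k-colouring col onto = ℚ.≤-trans (ℚ.≤-reflexive (·-average λₖ k)) (k-colouring-weight G min col onto)
    0<m : 0 ℕ.< m
    0<m = ℕ.≤-trans (ℕ.≤-trans (s≤s z≤n) 2≤k) k≤m
    0≤λₖ : 0ℚ ℚ.≤ λₖ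
    0≤λₖ = let F , _ , eq = proj₁ min in subst (0ℚ ℚ.≤_) eq (totalWeight-nonNegative G F)
    0≤u : 0ℚ ℚ.≤ u
    0≤u = ℚ.≤-trans (ℚ.≤-reflexive (sym (ℚ.*-zeroˡ 0ℚ)))
      (*-mono-≤ ℚ.≤-refl (ℚ.nonNegative⁻¹ (ℤ.1ℤ ℚ./ k) {{ℚ.normalize-nonNeg 1 k}}) 0≤λₖ
        (ℚ.nonNegative⁻¹ (ℤ.1ℤ ℚ./ k) {{ℚ.normalize-nonNeg 1 k}}))
    positive-average : ∀ S → totalWeight G (∂ G S) ℚ.< g ℚ.* u → 0ℚ ℚ.< u
    positive-average S cheap = ℚ.≰⇒> λ u≤0 → ℚ.<-irrefl refl (ℚ.≤-<-trans (totalWeight-nonNegative G (∂ G S))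
      (ℚ.<-≤-trans cheap (ℚ.≤-reflexive (trans (cong (g ℚ.*_) (ℚ.≤-antisym u≤0 0≤u)) (ℚ.*-zeroʳ g)))))
    1≤mh : 1ℚ ℚ.≤ ι m ℚ.* h
    1≤mh = ℚ.≤-trans (ℚ.≤-reflexive (sym (recip-inverseˡ 0<2-g)))
      (ℚ.*-monoʳ-≤-nonNeg h {{ℚ.nonNegative (ℚ.<⇒≤ 0<2-g)}} recip≤m)
    g+h : ∀ g u → g ℚ.* u ℚ.+ (ι 2 ℚ.- g) ℚ.* u ≡ u ℚ.+ u
    g+h = solve 2 (λ g u → g :* u :+ (con (ι 2) :- g) :* u := u :+ u) refl
      where open +-*-Solver
    light : (0<u : 0ℚ ℚ.< u) → ∀ {S} → IsCut S × totalWeight G (∂ G S) ℚ.< g ℚ.* u →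
      LightCuts.IsLight G k 2≤k u 0<u k-colouring m 0<m (lookup S)
    light 0<u {S} (cut , cheap) = (proj₁ (proper cut) , proj₂ (proper cut) , cheap₁) , cheap₂
      where
      d = wt (boundary (lookup S))
      d<gu : d ℚ.< g ℚ.* u
      d<gu = subst (ℚ._< g ℚ.* u) (totalWeight-tabulate G (boundary (lookup S))) cheap
      0≤hu : 0ℚ ℚ.≤ h ℚ.* u
      0≤hu = ℚ.≤-trans (ℚ.≤-reflexive (sym (ℚ.*-zeroˡ 0ℚ))) (*-mono-≤ ℚ.≤-refl 0≤u (ℚ.<⇒≤ 0<2-g) 0≤u)
      cheap₁ : d ℚ.< u ℚ.+ u
      cheap₁ = ℚ.<-≤-trans d<gu (ℚ.≤-trans (ℚ.≤-reflexive (sym (ℚ.+-identityʳ _)))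
        (ℚ.≤-trans (ℚ.+-monoʳ-≤ (g ℚ.* u) 0≤hu) (ℚ.≤-reflexive (g+h g u))))
      u≤mhu : u ℚ.≤ m · (h ℚ.* u)
      u≤mhu = ℚ.≤-trans (ℚ.≤-reflexive (sym (ℚ.*-identityˡ u)))
        (ℚ.≤-trans (ℚ.*-monoʳ-≤-nonNeg u {{ℚ.nonNegative 0≤u}} 1≤mh)
          (ℚ.≤-reflexive (trans (ℚ.*-assoc (ι m) h u) (sym (·-ι m (h ℚ.* u))))))
      -- From `1 ≤ m * h` the term `u` is at most `m · (h * u)`, and `g + h = 2`.
      cheap₂ : m · d ℚ.+ u ℚ.≤ m · (u ℚ.+ u)
      cheap₂ = ℚ.≤-trans (ℚ.+-mono-≤ (·-mono-≤ m (ℚ.<⇒≤ d<gu)) u≤mhu)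
        (ℚ.≤-reflexive (trans (sym (×-distrib-+ (g ℚ.* u) (h ℚ.* u) m)) (cong (m ·_) (g+h g u))))

-- From real inequalities to a single index.

-- Each real inequality holds with a gap from some index on; for a finite list the maximum of these
-- indices serves.
eventually-all : {A : Set} {P : A → Set} {d : A → ℚ} (x : ℝ) (xs : List A) →
  All (λ S → P S × fromℚ (d S) < x) xs → ∃ λ N → ∀ i → N ℕ.≤ i → All (λ S → P S × d S ℚ.< seq x i) xs
eventually-all x []       []       = 0 , λ _ _ → []
eventually-all {d = d} x (S ∷ xs) ((p , ε , 0<ε , M , h) ∷ ps) =
  let N , hN = eventually-all x xs ps in
  M ℕ.⊔ N , λ i M⊔N≤i → (p , ℚ.<-≤-trans (ℚ.≤-<-trans (ℚ.≤-reflexive (sym (ℚ.+-identityʳ (d S)))) (ℚ.+-monoʳ-< (d S) 0<ε))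
                             (h i (ℕ.m⊔n≤o⇒m≤o M N M⊔N≤i)))
                 ∷ hN i (ℕ.m⊔n≤o⇒n≤o M N M⊔N≤i)

theorem10 :
    ∃ λ (c : ℕ) → 0 ℕ.< c ×
      ((k : ℕ) .{{_ : NonZero k}} → 2 ℕ.≤ k →
       (n : ℕ) → k ℕ.≤ n → (G : Graph n) →
       (λₖ : ℚ) → IsMinKCutWeight G k λₖ →
       (γ : ℝ) (γ<2 : γ < fromℕ 2) →
       AtMost
         ((1/ (fromℕ 2 - γ) (x<y⇒0<y-x γ (fromℕ 2) γ<2) ⊔ fromℕ k) ^ (c ℕ.* k) * fromℕ n)
         (λ (S : Subset n) →
           IsCut S × fromℚ (totalWeight G (∂ G S)) < γ * fromℚ (average λₖ k)))
-- The exponent `8k` in `m` doubles when `m` gives way to the square of the base. The bound in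
-- `AtMost` is a negated strict inequality, whose assumed opposite supplies `δ` and `N₂`.
theorem10 = 16 , s≤s z≤n , λ k 2≤k n k≤n G λₖ min γ γ<2@(ε , 0<ε , N₁ , γ+ε≤2) xs unique all (δ , 0<δ , N₂ , bound+δ≤) →
  let M = 1/ (fromℕ 2 - γ) (x<y⇒0<y-x γ (fromℕ 2) γ<2) ⊔ fromℕ k
      N₃ , cheap = eventually-all {d = λ S → totalWeight G (∂ G S)} (γ * fromℚ (average λₖ k)) xs all
      -- At one index beyond all three thresholds, the claim becomes one about rationals.
      i = N₁ ℕ.⊔ (N₂ ℕ.⊔ N₃)
      N₁≤i = ℕ.m≤m⊔n N₁ (N₂ ℕ.⊔ N₃)
      N₂≤i = ℕ.≤-trans (ℕ.m≤m⊔n N₂ N₃) (ℕ.m≤n⊔m N₁ (N₂ ℕ.⊔ N₃))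
      N₃≤i = ℕ.≤-trans (ℕ.m≤n⊔m N₂ N₃) (ℕ.m≤n⊔m N₁ (N₂ ℕ.⊔ N₃))
      g = seq γ i
      q = seq M i
      0<2-g : 0ℚ ℚ.< ι 2 ℚ.- g
      0<2-g = ℚ.<-≤-trans 0<ε (ℚ.≤-trans (ℚ.≤-reflexive (cancel g ε)) (ℚ.+-monoˡ-≤ (ℚ.- g) (γ+ε≤2 i N₁≤i)))
      k≤q = ℚ.p≤q⊔p (recip (ι 2 ℚ.- g)) (ι k)
      -- The base is at least `k`, hence at least 2, as rounding requires.
      m , q≤m , m≤q² = roundUp (ℚ.≤-trans (ι-mono 2≤k) k≤q)
      few : length xs ℕ.≤ m ℕ.^ (8 ℕ.* k) ℕ.* n
      few = card-cheap-cuts G 2≤k k≤n min {g} 0<2-g (ι-cancel (ℚ.≤-trans k≤q q≤m))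
        (ℚ.≤-trans (ℚ.p≤p⊔q (recip (ι 2 ℚ.- g)) (ι k)) q≤m) xs unique (cheap i N₃≤i)
      power : ι (m ℕ.^ (8 ℕ.* k)) ℚ.≤ seq (M ^ (16 ℕ.* k)) i
      power = subst (λ j → ι (m ℕ.^ (8 ℕ.* k)) ℚ.≤ seq (M ^ j) i)
        (trans (ℕ.*-comm (8 ℕ.* k) 2) (sym (ℕ.*-assoc 2 8 k))) (power-bound M i m≤q² (8 ℕ.* k))
      length≤ : ι (length xs) ℚ.≤ seq (M ^ (16 ℕ.* k)) i ℚ.* ι n
      length≤ = ℚ.≤-trans (ι-mono few) (ℚ.≤-trans (ℚ.≤-reflexive (ι-* (m ℕ.^ (8 ℕ.* k)) n))
        (ℚ.*-monoʳ-≤-nonNeg (ι n) {{ℚ.nonNegative (0≤ι n)}} power))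
  in <⇒≱ℚ (ℚ.≤-<-trans (ℚ.≤-reflexive (sym (ℚ.+-identityʳ (ι (length xs))))) (ℚ.+-monoʳ-< (ι (length xs)) 0<δ))
       (ℚ.≤-trans (ℚ.+-monoˡ-≤ δ length≤) (bound+δ≤ i N₂≤i))
  where
  cancel : ∀ g ε → ε ≡ g ℚ.+ ε ℚ.- g
  cancel = solve 2 (λ g ε → ε := g :+ ε :- g) refl
    where open +-*-Solver
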